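{- Let $d$ be any non-negative integer constant and let $\Delta = 2d+2$. Then there is no deterministic distributed algorithm in the LOCAL model that runs in $o(\log^* n)$ rounds, where $n$ is the number of nodes of the input graph, and that finds a maximal fractional matching in every graph of maximum degree at most $\Delta$ using only edge values of the form $a/b$ with $a \in \{0,1,\dotsc,2^d\}$ and $b\in\{1,2,\dotsc,2^d\}$. (Here $d$ is fixed, and the constants hidden in the $o$-notation may depend on $d$.)
   Context: Fractional matching: for a finite simple graph $G=(V,E)$ and $x\colon E\to[0,1]$, write $x[v]=\sum_{e\in E: v\in e} x(e)$ for $v \in V$. The function $x$ is a fractional matching if $x[v]\le 1$ for all $v\in V$; it is a maximal fractional matching if in addition for every edge $\{u,v\}\in E$ at least one endpoint is saturated, i.e. $x[u]=1$ or $x[v]=1$. PN (port-numbering) model: each node of the input graph $G$ is a computer and each edge is a communication link. An adversary chooses a port numbering: each node $v$ of degree $\deg(v)$ refers to its incident edges by the numbers $1,\dotsc,\deg(v)$. Initially each node knows only its degree (and the global constant $\Delta$), and nodes of the same degree start in the same state. Computation is deterministic and proceeds in synchronous rounds; in each round each node sends a message (of arbitrary size) through each port, receives a message from each port, and updates its state by arbitrary local computation as a function of its current state and the received messages. A node may stop after any number of rounds and announce its local output, here the value $x(e)$ of each incident edge $e$ (the two endpoints of an edge must announce the same value). The running time is the number of rounds until all nodes have stopped; as a function of $n$ it is the worst case over all inputs with $n$ nodes. An algorithm must be correct for every input graph in the family and every port numbering. LOCAL model: the same as the PN model, except that each node is additionally given as input a unique identifier, chosen by an adversary from a set of size polynomial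 in $n=|V|$, e.g. $\{1,\dotsc,n^c\}$ for a fixed constant $c \ge 1$. An algorithm must be correct for every choice of unique identifiers. $\log^* n$ denotes the iterated logarithm. -}

module Defs where

open import Data.Bool using (if_then_else_)
open import Data.Fin using (Fin)
open import Data.Fin.Subset using (Subset; _∈_; _∉_; ∣_∣)
open import Data.Fin.Subset.Properties using (_∈?_)
open import Data.Integer using (+_)
open import Data.Maybe using (Maybe; just; nothing)
open import Data.Nat using (ℕ; zero; suc; 2+; _*_; _^_; _≤_; _<_; z≤n; s≤s)
open import Data.Nat.Induction using (Acc; acc; <-wellFounded)
open import Data.Nat.Logarithm using (⌈log₂_⌉; ⌈log₂⌉-mono-≤; ⌈log₂2^n⌉≡n)
open import Data.Nat.Properties using (≤-trans; ≤-reflexive; +-mono-≤; m^n>0; m≤m+n)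
open import Data.Product using (Σ; ∃; _×_; _,_; proj₁; proj₂)
open import Data.Rational as ℚ using (ℚ; 0ℚ; 1ℚ)
open import Data.Rational.Properties using (+-0-commutativeMonoid)
open import Data.Sum using (_⊎_)
open import Data.Vec using (Vec; lookup; tabulate)
open import Function.Bundles using (_↔_; module Inverse)
open import Function.Definitions using (Injective)
open import Relation.Binary.PropositionalEquality using (_≡_)
open import Relation.Nullary using (does)
open import Algebra.Properties.CommutativeMonoid.Sum +-0-commutativeMonoid using (sum)

------------------------------------------------------------------------
-- Growth rates

n<2^n : ∀ n → n < 2 ^ n
n<2^n zero    = s≤s z≤n
n<2^n (suc n) = +-mono-≤ (m^n>0 2 n) (≤-trans (n<2^n n) (m≤m+n _ 0))

⌈log₂2+n⌉<2+n : ∀ n → ⌈log₂ 2+ n ⌉ < 2+ n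
⌈log₂2+n⌉<2+n n =
  s≤s (≤-trans (⌈log₂⌉-mono-≤ (n<2^n (suc n))) (≤-reflexive (⌈log₂2^n⌉≡n (suc n))))

log*-acc : ∀ n → Acc _<_ n → ℕ
log*-acc 0      _        = 0
log*-acc 1      _        = 0
log*-acc (2+ n) (acc rs) = suc (log*-acc ⌈log₂ 2+ n ⌉ (rs (⌈log₂2+n⌉<2+n n)))

-- The number of times log₂ has to be applied to n before the result is at
-- most 1.  Rounding up after each step does not change this number: k steps
-- suffice iff n ≤ 2^2^…^2 (k twos), which is an integer threshold, and for an
-- integer m we have log₂ x ≤ m iff ⌈log₂ x⌉ ≤ m.
log* : ℕ → ℕ
log* n = log*-acc n (<-wellFounded n)

-- f(n) ≤ ε g(n) for all large n, where ε ranges over 1/k.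
_∈o_ : (ℕ → ℕ) → (ℕ → ℕ) → Set
f ∈o g = ∀ k → ∃ λ n₀ → ∀ n → n₀ ≤ n → k * f n ≤ g n

------------------------------------------------------------------------
-- Finite simple graphs, given by the neighbourhood of each node

record Graph (n : ℕ) : Set where
  field
    N      : Fin n → Subset n
    sym    : ∀ {u v} → u ∈ N v → v ∈ N u
    irrefl : ∀ v → v ∉ N v

  degree : Fin n → ℕ
  degree v = ∣ N v ∣

MaxDegree≤ : ∀ {n} → ℕ → Graph n → Set
MaxDegree≤ Δ G = ∀ v → Graph.degree G v ≤ Δ

------------------------------------------------------------------------
-- Fractional matchings

-- x u v is the value of the edge {u , v}; it carries no meaning when u and v
-- are not adjacent, and no definition below looks at it in that case.
record EdgeFunction {n} (G : Graph n) : Set where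
  open Graph G
  field
    value     : Fin n → Fin n → ℚ
    value-sym : ∀ {u v} → u ∈ N v → value u v ≡ value v u

  _[_] : Fin n → ℚ
  _[_] v = sum (λ u → if does (u ∈? N v) then value v u else 0ℚ)

module _ {n} {G : Graph n} (x : EdgeFunction G) where
  open Graph G
  open EdgeFunction x

  record IsFractionalMatching : Set where
    field
      inUnitInterval : ∀ {u v} → u ∈ N v → (0ℚ ℚ.≤ value u v) × (value u v ℚ.≤ 1ℚ)
      feasible       : ∀ v → _[_] v ℚ.≤ 1ℚ

  record IsMaximalFractionalMatching : Set where
    field
      isFractionalMatching : IsFractionalMatching
      saturated            : ∀ {u v} → u ∈ N v → (_[_] u ≡ 1ℚ) ⊎ (_[_] v ≡ 1ℚ)

  AllValues : (ℚ → Set) → Set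
  AllValues P = ∀ {u v} → u ∈ N v → P (value u v)

-- q = a / b with a ∈ {0, …, m} and b ∈ {1, …, m}.
FractionUpTo : ℕ → ℚ → Set
FractionUpTo m q = ∃ λ a → ∃ λ b → a ≤ m × suc b ≤ m × q ≡ + a ℚ./ suc b

------------------------------------------------------------------------
-- The LOCAL model

-- Each node numbers its incident edges, here identified with its neighbours.
PortNumbering : ∀ {n} → Graph n → Set
PortNumbering G = ∀ v → Fin (degree v) ↔ ∃ λ u → u ∈ N v
  where open Graph G

record Identifiers (c n : ℕ) : Set where
  field
    ident     : Fin n → ℕ
    injective : Injective _≡_ _≡_ ident
    positive  : ∀ v → 1 ≤ ident v
    bounded   : ∀ v → ident v ≤ n ^ c

-- A node of degree k with identifier i starts in the state init k i; it
-- knows neither its name in Fin n nor n.  A node has stopped when output is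
-- just its announcement, which lists the values of its edges by port.
record Algorithm : Set₁ where
  field
    State   : ℕ → Set
    Message : Set
    init    : ∀ k → ℕ → State k
    send    : ∀ {k} → State k → Vec Message k
    receive : ∀ {k} → State k → Vec Message k → State k
    output  : ∀ {k} → State k → Maybe (Vec ℚ k)

  -- A stopped node never changes its state again (its neighbours keep
  -- receiving the messages determined by that state).
  update : ∀ {k} → State k → Vec Message k → State k
  update s ms with output s
  ... | just _  = s
  ... | nothing = receive s ms

module Execution (A : Algorithm) {n c : ℕ} (G : Graph n)
                 (ports : PortNumbering G) (ids : Identifiers c n) where
  open Algorithm A
  open Graph G
  open Identifiers ids

  neighbour : ∀ v → Fin (degree v) → Fin n
  neighbour v i = proj₁ (Inverse.to (ports v) i)

  -- The port number that the neighbour reached through port i of v has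
  -- given to the same edge.
  backPort : ∀ v (i : Fin (degree v)) → Fin (degree (neighbour v i))
  backPort v i =
    Inverse.from (ports (neighbour v i)) (v , sym (proj₂ (Inverse.to (ports v) i)))

  stateAfter : ℕ → ∀ v → State (degree v)
  stateAfter zero    v = init (degree v) (ident v)
  stateAfter (suc t) v = update (stateAfter t v) (tabulate λ i →
    lookup (send (stateAfter t (neighbour v i))) (backPort v i))

  -- Within t rounds all nodes have stopped, and the two endpoints of each
  -- edge have both announced its value in x.
  Announces : ℕ → EdgeFunction G → Set
  Announces t x = ∀ v →
    output (stateAfter t v) ≡ just (tabulate λ i → EdgeFunction.value x v (neighbour v i))

-- On every graph with n nodes and maximum degree at most Δ, and for all
-- adversarial choices of port numbers and of identifiers in {1, …, n^c}, A
-- stops within T n rounds and its output is a maximal fractional matching all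
-- of whose edge values satisfy P.
FindsMFM : (c Δ : ℕ) (P : ℚ → Set) (A : Algorithm) (T : ℕ → ℕ) → Set
FindsMFM c Δ P A T =
  ∀ {n} (G : Graph n) → MaxDegree≤ Δ G →
  (ports : PortNumbering G) (ids : Identifiers c n) →
  ∃ λ (x : EdgeFunction G) →
    Execution.Announces A G ports ids (T n) x ×
    IsMaximalFractionalMatching x ×
    AllValues x P

-- The nodes are k-tuples of letters, where k = d + 1.  For k increasing
-- sequences of letters, the graph is the grid spanned by these sequences, and
-- all other nodes are isolated.  A colouring of the increasing p-tuples of
-- letters with few colours has two overlapping windows, shifted by one, of the
-- same colour as soon as the number of letters exceeds a tower of height O(p)
-- (the shift graph).  Since T n = o(log* n), this holds for side length
-- p = O(T n), so the sequences can be chosen such that replacing the sequence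
-- of any one axis by its shift does not change the values of the solution.  By
-- locality, the values v i τ of the edges {τ , τ + e i} at positions with
-- τ j ∈ {q - 1 , q} are then invariant under τ ↦ τ + e j, where q = 2 T n + 2 is
-- far from the boundary.  Hence at nodes τ ∈ [0 , q]^k with τ j = q we have
-- v j τ = v j (τ - e j), and both τ and τ + e j are saturated as one of them is.
--
-- Weigh the nodes τ of [0 , q]^k by the product over j of u (τ j), where
-- u b = - 2 (-1)^b for b < q, and u q = - 1.  The edges of each axis cancel by
-- telescoping, so the weighted sum of the deficits 1 - x[τ] is the total weight
-- (-1)^k.  But a deficit is zero if some τ j = q, and otherwise its weight is
-- ± 2^(d + 1).  As the values have denominators at most 2^d, the weighted sum
-- has positive 2-adic valuation: a contradiction.
module Submission where

open import Data.Bool using (Bool; true; false; if_then_else_)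
open import Data.Fin as Fin using (Fin; zero; suc; inject≤; funToFin; finToFun; combine; toℕ; fromℕ<)
import Data.Fin.Properties as Fin
open import Data.Fin.Subset using (Subset; _∈_; ∣_∣; ⁅_⁆; _∪_; inside; outside) renaming (⊥ to ∅)
open import Data.Fin.Subset.Properties using (_∈?_; nonempty?; p⊆q⇒∣p∣≤∣q∣; x∈p∪q⁺; ∣⊥∣≡0; ∣⁅x⁆∣≡1; x∈⁅x⁆; ⊆-antisym; Empty-unique)
open import Data.Integer as ℤ using (ℤ; +_)
import Data.Integer.Properties as ℤ
open import Data.List as List using (List; []; _∷_; allFin; _++_; length)
open import Data.List.Membership.Propositional using () renaming (_∈_ to _∈ˡ_)
import Data.List.Membership.Propositional.Properties as ∈ˡ
import Data.List.Properties as List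
open import Data.List.Relation.Unary.All as Allˡ using ([]; _∷_)
open import Data.List.Relation.Unary.AllPairs using ([]; _∷_)
open import Data.List.Relation.Unary.Any using (here; there)
open import Data.List.Relation.Unary.Unique.Propositional using (Unique)
import Data.List.Relation.Unary.Unique.Propositional.Properties as Unique
open import Data.Maybe as Maybe using (Maybe; just; nothing; maybe′)
import Data.Maybe.Properties as Maybe
open import Data.Nat as ℕ using (ℕ; zero; suc; _≤_; _<_; z≤n; s≤s; s≤s⁻¹; 2+; _^_; _⊔_; _+_; _*_)
open import Data.Nat.Divisibility using (divides; _∣_; ∣m+n∣m⇒∣n; m∣m*n; ∣1⇒≡1)
open import Data.Nat.Induction using (Acc; acc; <-wellFounded)
open import Data.Nat.Logarithm using (⌈log₂⌉-mono-≤; ⌈log₂2^n⌉≡n)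
import Data.Nat.Properties as ℕ
import Data.Nat.Solver as ℕ
open import Data.Product using (∃; ∃₂; _×_; _,_; proj₁; proj₂; Σ; Σ-syntax)
open import Data.Rational as ℚ using (ℚ; 0ℚ; 1ℚ; toℚᵘ; fromℚᵘ) renaming (_+_ to _⊕_; _*_ to _⊛_; _-_ to _⊖_; -_ to ⊝_)
import Data.Rational.Properties as ℚ
open import Data.Rational.Solver using (module +-*-Solver)
open import Data.Rational.Unnormalised as ℚᵘ using (ℚᵘ; mkℚᵘ; *≡*; _≃_)
import Data.Rational.Unnormalised.Properties as ℚᵘ
open import Data.Sum as Sum using (_⊎_; inj₁; inj₂)
open import Data.Unit using (⊤; tt)
open import Data.Vec as Vec using (Vec; []; _∷_; lookup; tabulate; map; head; tail; here; there)
import Data.Vec.Properties as Vec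
import Data.Vec.Properties.WithK as Vec
open import Data.Vec.Relation.Unary.All as All using (All; []; _∷_)
open import Defs
open import Function using (_∘_)
open import Function.Bundles using (_↔_; mk↔ₛ′; module Inverse)
open import Relation.Binary.Definitions using (tri<; tri≈; tri>)
open import Relation.Binary.PropositionalEquality using (_≡_; _≢_; refl; sym; trans; cong; cong₂; subst; subst₂; module ≡-Reasoning)
open import Relation.Nullary using (¬_; yes; no; contradiction; Dec; does)
open import Relation.Nullary.Decidable using (_×-dec_; dec-true; _⊎-dec_; map′)
open import Algebra.Properties.CommutativeMonoid.Sum ℚ.+-0-commutativeMonoid using (sum; sum-cong-≗; ∑-distrib-+; sum-replicate-zero)

-- Positions in the grid

inc : ∀ {k} → Fin k → Vec ℕ k → Vec ℕ k
inc zero    (b ∷ τ) = suc b ∷ τ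
inc (suc i) (b ∷ τ) = b ∷ inc i τ

dec? : ∀ {k} → Fin k → Vec ℕ k → Maybe (Vec ℕ k)
dec? zero    (zero  ∷ τ) = nothing
dec? zero    (suc b ∷ τ) = just (b ∷ τ)
dec? (suc i) (b ∷ τ)     = Maybe.map (b ∷_) (dec? i τ)

-- When `v σ` is the value of the edge from `σ` to `inc i σ`, this is the value of the edge entering
-- `τ` along axis `i`. The default `0ℚ` stands for the missing edge at the lower boundary.
back : ∀ {k} → Fin k → (Vec ℕ k → ℚ) → Vec ℕ k → ℚ
back i v τ = maybe′ v 0ℚ (dec? i τ)

-- The 2-adic obstruction

Σℚ : ∀ {A : Set} → List A → (A → ℚ) → ℚ
Σℚ []       f = 0ℚ
Σℚ (i ∷ is) f = f i ⊕ Σℚ is f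

alt : (ℕ → ℚ) → ℕ → ℚ
alt g zero    = 0ℚ
alt g (suc b) = g b ⊖ alt g b

-- The weights 2 (-1)^(q - 1 - b) for b < q, and - 1 for b = q.
line : ℕ → (ℕ → ℚ) → ℚ
line q g = (alt g q ⊕ alt g q) ⊖ g q

tensor : ∀ q {k} → (Vec ℕ k → ℚ) → ℚ
tensor q {zero}  f = f []
tensor q {suc k} f = line q (λ b → tensor q (λ τ → f (b ∷ τ)))

alt-cong : ∀ {g h} q → (∀ b → b < q → g b ≡ h b) → alt g q ≡ alt h q
alt-cong zero    e = refl
alt-cong (suc q) e = cong₂ _⊖_ (e q ℕ.≤-refl) (alt-cong q λ b b<q → e b (ℕ.m≤n⇒m≤1+n b<q))

line-cong : ∀ {g h} q → (∀ b → b ≤ q → g b ≡ h b) → line q g ≡ line q h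
line-cong q e = cong₂ _⊖_ (cong₂ _⊕_ p p) (e q ℕ.≤-refl)
  where p = alt-cong q (λ b b<q → e b (ℕ.<⇒≤ b<q))

tensor-cong : ∀ q {k} {f g : Vec ℕ k → ℚ} →
              (∀ τ → All (_≤ q) τ → f τ ≡ g τ) → tensor q f ≡ tensor q g
tensor-cong q {zero}  e = e [] []
tensor-cong q {suc k} e =
  line-cong q λ b b≤q → tensor-cong q λ τ τ≤q → e (b ∷ τ) (b≤q ∷ τ≤q)

alt-⊖ : ∀ g h q → alt (λ b → g b ⊖ h b) q ≡ alt g q ⊖ alt h q
alt-⊖ g h zero    = refl
alt-⊖ g h (suc q) = trans (cong ((g q ⊖ h q) ⊖_) (alt-⊖ g h q))
  (solve 4 (λ a b c d → (a :- b) :- (c :- d) := (a :- c) :- (b :- d)) refl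
     (g q) (h q) (alt g q) (alt h q))
  where open +-*-Solver

line-⊖ : ∀ q g h → line q (λ b → g b ⊖ h b) ≡ line q g ⊖ line q h
line-⊖ q g h = trans (cong (λ t → (t ⊕ t) ⊖ (g q ⊖ h q)) (alt-⊖ g h q))
  (solve 4 (λ a b c d → ((c :- d) :+ (c :- d)) :- (a :- b) :=
                        ((c :+ c) :- a) :- ((d :+ d) :- b)) refl
     (g q) (h q) (alt g q) (alt h q))
  where open +-*-Solver

tensor-⊖ : ∀ q {k} (f g : Vec ℕ k → ℚ) →
           tensor q (λ τ → f τ ⊖ g τ) ≡ tensor q f ⊖ tensor q g
tensor-⊖ q {zero}  f g = refl
tensor-⊖ q {suc k} f g =
  trans (line-cong q λ b _ → tensor-⊖ q (λ τ → f (b ∷ τ)) (λ τ → g (b ∷ τ)))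
        (line-⊖ q _ _)

alt-0 : ∀ q → alt (λ _ → 0ℚ) q ≡ 0ℚ
alt-0 zero    = refl
alt-0 (suc q) = cong (0ℚ ⊖_) (alt-0 q)

tensor-0 : ∀ q k → tensor q {k} (λ _ → 0ℚ) ≡ 0ℚ
tensor-0 q zero    = refl
tensor-0 q (suc k) =
  trans (line-cong q λ _ _ → tensor-0 q k) (cong (λ t → (t ⊕ t) ⊖ 0ℚ) (alt-0 q))

tensor-⊕ : ∀ q {k} (f g : Vec ℕ k → ℚ) →
           tensor q (λ τ → f τ ⊕ g τ) ≡ tensor q f ⊕ tensor q g
tensor-⊕ q {k} f g = begin
  tensor q (λ τ → f τ ⊕ g τ)
    ≡⟨ tensor-cong q (λ τ _ → plus (f τ) (g τ)) ⟩
  tensor q (λ τ → f τ ⊖ (0ℚ ⊖ g τ))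
    ≡⟨ tensor-⊖ q f (λ τ → 0ℚ ⊖ g τ) ⟩
  tensor q f ⊖ tensor q (λ τ → 0ℚ ⊖ g τ)
    ≡⟨ cong (tensor q f ⊖_) (trans (tensor-⊖ q (λ _ → 0ℚ) g) (cong (_⊖ tensor q g) (tensor-0 q k))) ⟩
  tensor q f ⊖ (0ℚ ⊖ tensor q g)
    ≡⟨ plus (tensor q f) (tensor q g) ⟨
  tensor q f ⊕ tensor q g ∎
  where
  open ≡-Reasoning
  plus : ∀ a b → a ⊕ b ≡ a ⊖ (0ℚ ⊖ b)
  plus = let open +-*-Solver in solve 2 (λ a b → a :+ b := a :- (con 0ℚ :- b)) refl

tensor-Σ : ∀ q {k} {A : Set} (is : List A) (f : A → Vec ℕ k → ℚ) →
           tensor q (λ τ → Σℚ is (λ i → f i τ)) ≡ Σℚ is (λ i → tensor q (f i))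
tensor-Σ q {k} []   f = tensor-0 q k
tensor-Σ q (i ∷ is) f =
  trans (tensor-⊕ q (f i) (λ τ → Σℚ is (λ i → f i τ))) (cong (tensor q (f i) ⊕_) (tensor-Σ q is f))

shiftℚ : (ℕ → ℚ) → ℕ → ℚ
shiftℚ v zero    = 0ℚ
shiftℚ v (suc b) = v b

-- Each edge meets two consecutive positions, so the alternating sum over `b < q` collapses to its
-- last edge `shiftℚ v q`. Doubled, it cancels against the two edges at position `q`, which have
-- equal values by hypothesis.
line-telescope : ∀ q (v : ℕ → ℚ) → v q ≡ shiftℚ v q → line q (λ b → v b ⊕ shiftℚ v b) ≡ 0ℚ
line-telescope q v e = trans (cong₂ (λ s t → (s ⊕ s) ⊖ (t ⊕ shiftℚ v q)) (go q) e)
  (solve 1 (λ a → (a :+ a) :- (a :+ a) := con 0ℚ) refl (shiftℚ v q))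
  where
  open +-*-Solver
  go : ∀ q → alt (λ b → v b ⊕ shiftℚ v b) q ≡ shiftℚ v q
  go zero    = refl
  go (suc q) = trans (cong ((v q ⊕ shiftℚ v q) ⊖_) (go q))
    (solve 2 (λ a b → (a :+ b) :- b := a) refl (v q) (shiftℚ v q))

-- The axes before `i` are stripped off one by one, each leaving a combination of zeros; on axis `i`
-- itself, `line-telescope` applies to the sums `w b` over the slices.
tensor-telescope : ∀ q {k} (i : Fin k) (v : Vec ℕ k → ℚ) →
  (∀ τ → All (_≤ q) τ → lookup τ i ≡ q → v τ ≡ back i v τ) →
  tensor q (λ τ → v τ ⊕ back i v τ) ≡ 0ℚ
tensor-telescope q {suc k} zero v e = begin
  line q (λ b → tensor q (λ τ → v (b ∷ τ) ⊕ back zero v (b ∷ τ)))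
    ≡⟨ line-cong q (λ b _ → trans (tensor-⊕ q (λ τ → v (b ∷ τ)) (λ τ → back zero v (b ∷ τ))) (cong (w b ⊕_) (w-back b))) ⟩
  line q (λ b → w b ⊕ shiftℚ w b)
    ≡⟨ line-telescope q w (trans (tensor-cong q (λ τ τ≤q → e (q ∷ τ) (ℕ.≤-refl ∷ τ≤q) refl)) (w-back q)) ⟩
  0ℚ ∎
  where
  open ≡-Reasoning
  w : ℕ → ℚ
  w b = tensor q (λ τ → v (b ∷ τ))
  w-back : ∀ b → tensor q (λ τ → back zero v (b ∷ τ)) ≡ shiftℚ w b
  w-back zero    = tensor-0 q k
  w-back (suc b) = refl
tensor-telescope q (suc i) v e =
  trans (line-cong q λ b b≤q →
           trans (tensor-cong q λ τ _ → cong (v (b ∷ τ) ⊕_) (push b τ))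
                 (tensor-telescope q i (λ τ → v (b ∷ τ)) λ τ τ≤q τᵢ≡q →
                    trans (e (b ∷ τ) (b≤q ∷ τ≤q) τᵢ≡q) (push b τ)))
        (cong (λ t → (t ⊕ t) ⊖ 0ℚ) (alt-0 q))
  where
  push : ∀ b τ → back (suc i) v (b ∷ τ) ≡ back i (λ τ → v (b ∷ τ)) τ
  push b τ with dec? i τ
  ... | just _  = refl
  ... | nothing = refl

-- Abstract form of lower bounds on a 2-adic valuation: each `P j` is an additive subgroup, and
-- doubling raises the index.
record Filtration (P : ℕ → ℚ → Set) : Set where
  field
    P-0      : ∀ {j} → P j 0ℚ
    P-⊖      : ∀ {j x y} → P j x → P j y → P j (x ⊖ y)
    P-double : ∀ {j x} → P j x → P (suc j) (x ⊕ x)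

  P-⊕ : ∀ {j x y} → P j x → P j y → P j (x ⊕ y)
  P-⊕ {j} {x} {y} p r = subst (P j)
    (solve 2 (λ a b → a :- (con 0ℚ :- b) := a :+ b) refl x y) (P-⊖ p (P-⊖ P-0 r))
    where open +-*-Solver

  P-Σ : ∀ {j} {A : Set} (is : List A) {f : A → ℚ} → (∀ i → P j (f i)) → P j (Σℚ is f)
  P-Σ []       p = P-0
  P-Σ (i ∷ is) p = P-⊕ (p i) (P-Σ is p)

  P-alt : ∀ {j} g q → (∀ b → b < q → P j (g b)) → P j (alt g q)
  P-alt g zero    p = P-0
  P-alt g (suc q) p = P-⊖ (p q ℕ.≤-refl) (P-alt g q λ b b<q → p b (ℕ.m≤n⇒m≤1+n b<q))

  -- As `f` vanishes on every face with a coordinate `q`, only the doubled alternating sum survives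
  -- along each axis, and each of the `k` axes raises the index by one.
  P-tensor : ∀ q {k} (f : Vec ℕ k → ℚ) → (∀ τ → All (_≤ q) τ → P 0 (f τ)) →
             (∀ τ i → All (_≤ q) τ → lookup τ i ≡ q → f τ ≡ 0ℚ) → P k (tensor q f)
  P-tensor q {zero}  f p f≡0 = p [] []
  P-tensor q {suc k} f p f≡0 = subst (P (suc k))
    (trans (x⊖0 (alt g q ⊕ alt g q)) (cong ((alt g q ⊕ alt g q) ⊖_) (sym g[q]≡0)))
    (P-double (P-alt g q λ b b<q → P-tensor q (λ τ → f (b ∷ τ))
      (λ τ τ≤q → p (b ∷ τ) (ℕ.<⇒≤ b<q ∷ τ≤q))
      (λ τ i τ≤q → f≡0 (b ∷ τ) (suc i) (ℕ.<⇒≤ b<q ∷ τ≤q))))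
    where
    g : ℕ → ℚ
    g b = tensor q (λ τ → f (b ∷ τ))
    x⊖0 : ∀ x → x ≡ x ⊖ 0ℚ
    x⊖0 = let open +-*-Solver in solve 1 (λ x → x := x :- con 0ℚ) refl
    g[q]≡0 : g q ≡ 0ℚ
    g[q]≡0 = trans (tensor-cong q λ τ τ≤q → f≡0 (q ∷ τ) zero (ℕ.≤-refl ∷ τ≤q) refl) (tensor-0 q k)

sgn : ℕ → ℚ
sgn zero    = 1ℚ
sgn (suc k) = ⊝ (sgn k)

-- The side is even, so the alternating sum of a constant is zero and only the weight - 1 at the
-- last position survives: one sign per axis.
tensor-1 : ∀ r {k} → tensor (r ℕ.* 2) {k} (λ _ → 1ℚ) ≡ sgn k
tensor-1 r {zero}  = refl
tensor-1 r {suc k} = trans (line-cong (r ℕ.* 2) λ _ _ → tensor-1 r {k})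
  (trans (cong (λ t → (t ⊕ t) ⊖ sgn k) (alt-const r))
         (solve 1 (λ x → (con 0ℚ :+ con 0ℚ) :- x := :- x) refl (sgn k)))
  where
  open +-*-Solver
  alt-const : ∀ r {x} → alt (λ _ → x) (r ℕ.* 2) ≡ 0ℚ
  alt-const zero        = refl
  alt-const (suc r) {x} = trans (cong (λ t → x ⊖ (x ⊖ t)) (alt-const r))
    (solve 1 (λ x → x :- (x :- con 0ℚ) := con 0ℚ) refl x)

-- The sum of the edge values at a grid node with all its forward edges present, grouped by axis so
-- that telescoping applies to each summand.
load : ∀ {k} → (Fin k → Vec ℕ k → ℚ) → Vec ℕ k → ℚ
load {k} v τ = Σℚ (allFin k) (λ i → v i τ ⊕ back i (v i) τ)

Σℚ-0 : ∀ {A : Set} (is : List A) {f : A → ℚ} → (∀ i → f i ≡ 0ℚ) → Σℚ is f ≡ 0ℚ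
Σℚ-0 []       e = refl
Σℚ-0 (i ∷ is) e = trans (cong₂ _⊕_ (e i) (Σℚ-0 is e)) refl

module _ {P : ℕ → ℚ → Set} (F : Filtration P) where
  open Filtration F

  -- The weighted sum of the deficits is evaluated twice: periodicity makes the loads cancel and
  -- leaves `sgn k`, while saturation on the upper faces makes `P-tensor` applicable.
  deficit-obstruction : ∀ {k} r (v : Fin k → Vec ℕ k → ℚ) → let q = r ℕ.* 2 in
    P 0 1ℚ →
    (∀ i τ → All (_≤ q) τ → P 0 (v i τ)) →
    (∀ i τ → All (_≤ q) τ → lookup τ i ≡ q → v i τ ≡ back i (v i) τ) →
    (∀ i τ → All (_≤ q) τ → lookup τ i ≡ q → load v τ ≡ 1ℚ) →
    P k (sgn k)
  deficit-obstruction {k} r v p1 pv ve sat = subst (P k) total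
    (P-tensor q deficit
      (λ τ τ≤q → P-⊖ p1 (P-Σ (allFin k) λ i → P-⊕ (pv i τ τ≤q) (P-back i τ τ≤q)))
      (λ τ i τ≤q τᵢ≡q → trans (cong (1ℚ ⊖_) (sat i τ τ≤q τᵢ≡q)) refl))
    where
    q = r ℕ.* 2
    deficit : Vec ℕ k → ℚ
    deficit τ = 1ℚ ⊖ load v τ

    dec?-≤ : ∀ {k} (i : Fin k) τ {σ} → dec? i τ ≡ just σ → All (_≤ q) τ → All (_≤ q) σ
    dec?-≤ zero    (suc b ∷ τ) refl (b<q ∷ τ≤q) = ℕ.<⇒≤ b<q ∷ τ≤q
    dec?-≤ (suc i) (b ∷ τ) e (b≤q ∷ τ≤q) with dec? i τ in e′
    dec?-≤ (suc i) (b ∷ τ) refl (b≤q ∷ τ≤q) | just σ = b≤q ∷ dec?-≤ i τ e′ τ≤q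

    P-back : ∀ i τ → All (_≤ q) τ → P 0 (back i (v i) τ)
    P-back i τ τ≤q with dec? i τ in e
    ... | nothing = P-0
    ... | just σ  = pv i σ (dec?-≤ i τ e τ≤q)

    total : tensor q deficit ≡ sgn k
    total = trans (tensor-⊖ q (λ _ → 1ℚ) (load v)) (trans (cong₂ _⊖_ (tensor-1 r {k})
      (trans (tensor-Σ q (allFin k) (λ i τ → v i τ ⊕ back i (v i) τ))
             (Σℚ-0 (allFin k) λ i → tensor-telescope q i (v i) (ve i))))
      (solve 1 (λ x → x :- con 0ℚ := x) refl (sgn k)))
      where open +-*-Solver

-- 2-adic filtration

ι : ℤ → ℚ
ι z = fromℚᵘ (mkℚᵘ z 0)

toℚᵘ-ι : ∀ z → toℚᵘ (ι z) ≃ mkℚᵘ z 0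
toℚᵘ-ι z = ℚ.toℚᵘ-fromℚᵘ (mkℚᵘ z 0)

ι-injective : ∀ {a b} → ι a ≡ ι b → a ≡ b
ι-injective {a} {b} e with ℚ.fromℚᵘ-injective {mkℚᵘ a 0} {mkℚᵘ b 0} e
... | *≡* eq = trans (sym (ℤ.*-identityʳ a)) (trans eq (ℤ.*-identityʳ b))

ι-⊛ : ∀ a b → ι (a ℤ.* b) ≡ ι a ⊛ ι b
ι-⊛ a b = ℚ.toℚᵘ-injective (begin
  toℚᵘ (ι (a ℤ.* b))         ≈⟨ toℚᵘ-ι (a ℤ.* b) ⟩
  mkℚᵘ a 0 ℚᵘ.* mkℚᵘ b 0     ≈⟨ ℚᵘ.*-cong (toℚᵘ-ι a) (toℚᵘ-ι b) ⟨
  toℚᵘ (ι a) ℚᵘ.* toℚᵘ (ι b) ≈⟨ ℚ.toℚᵘ-homo-* (ι a) (ι b) ⟨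
  toℚᵘ (ι a ⊛ ι b)           ∎)
  where open import Relation.Binary.Reasoning.Setoid ℚᵘ.≃-setoid

ι-⊕ : ∀ a b → ι (a ℤ.+ b) ≡ ι a ⊕ ι b
ι-⊕ a b = ℚ.toℚᵘ-injective (begin
  toℚᵘ (ι (a ℤ.+ b))         ≈⟨ toℚᵘ-ι (a ℤ.+ b) ⟩
  mkℚᵘ (a ℤ.+ b) 0           ≡⟨ cong₂ (λ s t → mkℚᵘ (s ℤ.+ t) 0) (ℤ.*-identityʳ a) (ℤ.*-identityʳ b) ⟨
  mkℚᵘ a 0 ℚᵘ.+ mkℚᵘ b 0     ≈⟨ ℚᵘ.+-cong (toℚᵘ-ι a) (toℚᵘ-ι b) ⟨
  toℚᵘ (ι a) ℚᵘ.+ toℚᵘ (ι b) ≈⟨ ℚ.toℚᵘ-homo-+ (ι a) (ι b) ⟨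
  toℚᵘ (ι a ⊕ ι b)           ∎)
  where open import Relation.Binary.Reasoning.Setoid ℚᵘ.≃-setoid

ι-⊝ : ∀ a → ι (ℤ.- a) ≡ ⊝ (ι a)
ι-⊝ a = ℚ.toℚᵘ-injective (begin
  toℚᵘ (ι (ℤ.- a))     ≈⟨ toℚᵘ-ι (ℤ.- a) ⟩
  ℚᵘ.- mkℚᵘ a 0        ≈⟨ ℚᵘ.-‿cong (toℚᵘ-ι a) ⟨
  ℚᵘ.- toℚᵘ (ι a)      ≈⟨ ℚ.toℚᵘ-homo‿- (ι a) ⟨
  toℚᵘ (⊝ ι a)         ∎)
  where open import Relation.Binary.Reasoning.Setoid ℚᵘ.≃-setoid

ι-/ : ∀ a b → ι (+ suc b) ⊛ (a ℚ./ suc b) ≡ ι a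
ι-/ a b = ℚ.toℚᵘ-injective (begin
  toℚᵘ (ι (+ suc b) ⊛ (a ℚ./ suc b))
    ≈⟨ ℚ.toℚᵘ-homo-* (ι (+ suc b)) (a ℚ./ suc b) ⟩
  toℚᵘ (ι (+ suc b)) ℚᵘ.* toℚᵘ (fromℚᵘ (mkℚᵘ a b))
    ≈⟨ ℚᵘ.*-cong (toℚᵘ-ι (+ suc b)) (ℚ.toℚᵘ-fromℚᵘ (mkℚᵘ a b)) ⟩
  mkℚᵘ (+ suc b) 0 ℚᵘ.* mkℚᵘ a b
    ≈⟨ *≡* (trans (ℤ.*-identityʳ _) (trans (ℤ.*-comm (+ suc b) a) (cong (λ t → a ℤ.* (+ t)) (sym (ℕ.*-identityˡ (suc b)))))) ⟩
  mkℚᵘ a 0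
    ≈⟨ toℚᵘ-ι a ⟨
  toℚᵘ (ι a) ∎)
  where open import Relation.Binary.Reasoning.Setoid ℚᵘ.≃-setoid

odd : ℕ → ℕ
odd e = suc (2 ℕ.* e)

infix 9 2^_
2^_ : ℕ → ℤ
2^ j = + (2 ℕ.^ j)

-- x has 2-adic valuation at least j - d.
TwoAdic : ℕ → ℕ → ℚ → Set
TwoAdic d j x = ∃₂ λ e z → ι (+ odd e) ⊛ (ι (2^ d) ⊛ x) ≡ ι (2^ j ℤ.* z)

odd-* : ∀ e f → ∃ λ g → odd g ≡ odd e ℕ.* odd f
odd-* e f = e ℕ.+ f ℕ.+ 2 ℕ.* (e ℕ.* f) , solve 2 (λ e f → con 1 :+ con 2 :* (e :+ f :+ con 2 :* (e :* f)) :=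
                          (con 1 :+ con 2 :* e) :* (con 1 :+ con 2 :* f)) refl e f
  where open ℕ.+-*-Solver

twoAdic-filtration : ∀ d → Filtration (TwoAdic d)
twoAdic-filtration d = record
  { P-0      = λ {j} → 0 , + 0 , trans (cong (ι (+ 1) ⊛_) (ℚ.*-zeroʳ (ι (2^ d))))
                                       (sym (cong ι (ℤ.*-zeroʳ (2^ j))))
  ; P-⊖      = λ {j} → minus {j}
  ; P-double = λ {j} → double {j}
  }
  where
  open +-*-Solver
  minus : ∀ {j x y} → TwoAdic d j x → TwoAdic d j y → TwoAdic d j (x ⊖ y)
  minus {j} {x} {y} (e , z , p) (f , w , r) with odd-* e f
  -- The product of the two odd multipliers clears the odd denominators of both `x` and `y`.
  ... | g , g≡ef = g , (+ odd f ℤ.* z ℤ.- + odd e ℤ.* w) , (begin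
    ι (+ odd g) ⊛ (D ⊛ (x ⊖ y))
      ≡⟨ cong (_⊛ (D ⊛ (x ⊖ y))) (trans (cong (λ t → ι (+ t)) g≡ef) (trans (cong ι (ℤ.pos-* (odd e) (odd f))) (ι-⊛ (+ odd e) (+ odd f)))) ⟩
    (E ⊛ G) ⊛ (D ⊛ (x ⊖ y))
      ≡⟨ solve 5 (λ E G D x y → (E :* G) :* (D :* (x :- y)) := G :* (E :* (D :* x)) :- E :* (G :* (D :* y))) refl E G D x y ⟩
    G ⊛ (E ⊛ (D ⊛ x)) ⊖ E ⊛ (G ⊛ (D ⊛ y))
      ≡⟨ cong₂ (λ s t → G ⊛ s ⊖ E ⊛ t) (trans p (ι-⊛ (2^ j) z)) (trans r (ι-⊛ (2^ j) w)) ⟩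
    G ⊛ (J ⊛ ι z) ⊖ E ⊛ (J ⊛ ι w)
      ≡⟨ solve 5 (λ E G J z w → G :* (J :* z) :- E :* (J :* w) := J :* (G :* z :- E :* w)) refl E G J (ι z) (ι w) ⟩
    J ⊛ (G ⊛ ι z ⊖ E ⊛ ι w)
      ≡⟨ cong (J ⊛_) (trans (ι-⊕ (+ odd f ℤ.* z) (ℤ.- (+ odd e ℤ.* w))) (cong₂ _⊕_ (ι-⊛ (+ odd f) z) (trans (ι-⊝ (+ odd e ℤ.* w)) (cong ⊝_ (ι-⊛ (+ odd e) w))))) ⟨
    J ⊛ ι (+ odd f ℤ.* z ℤ.- + odd e ℤ.* w)
      ≡⟨ ι-⊛ (2^ j) _ ⟨
    ι (2^ j ℤ.* (+ odd f ℤ.* z ℤ.- + odd e ℤ.* w)) ∎)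
    where
    open ≡-Reasoning
    D = ι (2^ d)
    E = ι (+ odd e)
    G = ι (+ odd f)
    J = ι (2^ j)
  double : ∀ {j x} → TwoAdic d j x → TwoAdic d (suc j) (x ⊕ x)
  double {j} {x} (e , z , p) = e , z , (begin
    E ⊛ (D ⊛ (x ⊕ x))
      ≡⟨ solve 3 (λ E D x → E :* (D :* (x :+ x)) := E :* (D :* x) :+ E :* (D :* x)) refl E D x ⟩
    E ⊛ (D ⊛ x) ⊕ E ⊛ (D ⊛ x)
      ≡⟨ cong₂ _⊕_ p p ⟩
    ι (2^ j ℤ.* z) ⊕ ι (2^ j ℤ.* z)
      ≡⟨ ι-⊕ (2^ j ℤ.* z) (2^ j ℤ.* z) ⟨
    ι (2^ j ℤ.* z ℤ.+ 2^ j ℤ.* z)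
      ≡⟨ cong ι (sym (ℤ.*-distribʳ-+ z (2^ j) (2^ j))) ⟩
    ι ((2^ j ℤ.+ 2^ j) ℤ.* z)
      ≡⟨ cong (λ t → ι (t ℤ.* z)) (cong (λ t → + (2 ℕ.^ j ℕ.+ t)) (sym (ℕ.+-identityʳ (2 ℕ.^ j)))) ⟩
    ι (2^ suc j ℤ.* z) ∎)
    where
    open ≡-Reasoning
    D = ι (2^ d)
    E = ι (+ odd e)

odd≢2* : ∀ e z → + odd e ≢ + 2 ℤ.* z
odd≢2* e z eq = contradiction (∣1⇒≡1 (∣m+n∣m⇒∣n 2∣2e+1 (m∣m*n {2} e))) λ ()
  where
  2∣2e+1 : 2 ∣ 2 ℕ.* e ℕ.+ 1
  2∣2e+1 = divides ℤ.∣ z ∣ (trans (ℕ.+-comm (2 ℕ.* e) 1)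
    (trans (cong ℤ.∣_∣ eq) (trans (ℤ.abs-* (+ 2) z) (ℕ.*-comm 2 ℤ.∣ z ∣))))

-- At index `suc d`, cancelling `2^ d` would leave an odd integer equal to an even one.
1∉TwoAdic : ∀ d → ¬ TwoAdic d (suc d) 1ℚ
1∉TwoAdic d (e , z , p) = odd≢2* e z (ℤ.*-cancelˡ-≡ (2^ d) (+ odd e) (+ 2 ℤ.* z) {{ℕ.m^n≢0 2 d}} (ι-injective (begin
  ι (2^ d ℤ.* + odd e)          ≡⟨ ι-⊛ (2^ d) (+ odd e) ⟩
  ι (2^ d) ⊛ ι (+ odd e)        ≡⟨ solve 2 (λ D E → D :* E := E :* (D :* con 1ℚ)) refl (ι (2^ d)) (ι (+ odd e)) ⟩
  ι (+ odd e) ⊛ (ι (2^ d) ⊛ 1ℚ) ≡⟨ p ⟩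
  ι (2^ suc d ℤ.* z)            ≡⟨ cong ι (cong (λ t → t ℤ.* z) (trans (ℤ.pos-* 2 (2 ℕ.^ d)) (ℤ.*-comm (+ 2) (2^ d)))) ⟩
  ι (2^ d ℤ.* + 2 ℤ.* z)        ≡⟨ cong ι (ℤ.*-assoc (2^ d) (+ 2) z) ⟩
  ι (2^ d ℤ.* (+ 2 ℤ.* z))      ∎)))
  where open ≡-Reasoning; open +-*-Solver

sgn∉TwoAdic : ∀ d k → ¬ TwoAdic d (suc d) (sgn k)
sgn∉TwoAdic d zero    = 1∉TwoAdic d
sgn∉TwoAdic d (suc k) p = sgn∉TwoAdic d k (subst (TwoAdic d (suc d))
  (solve 1 (λ x → con 0ℚ :- (:- x) := x) refl (sgn k)) (P-⊖ {suc d} (P-0 {suc d}) p))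
  where
  open Filtration (twoAdic-filtration d)
  open +-*-Solver

-- The power of two dividing `suc b` is at most `2 ^ d` by size, so it divides `2 ^ d`. The
-- recursion halves `suc b` and lowers `d` together, until `suc b` is odd and is its own odd part.
odd-part : ∀ d b → suc b ≤ 2 ℕ.^ d → ∃₂ λ e c → odd e ℕ.* 2 ℕ.^ d ≡ c ℕ.* suc b
odd-part zero    zero    _  = 0 , 1 , refl
odd-part zero    (suc b) (s≤s ())
odd-part (suc d) b b<2^d with even∨odd b
  where
  even∨odd : ∀ b → (∃ λ f → b ≡ 2 ℕ.* f) ⊎ (∃ λ f → suc b ≡ 2 ℕ.* suc f)
  even∨odd zero = inj₁ (0 , refl)
  even∨odd (suc b) with even∨odd b
  ... | inj₁ (f , refl) = inj₂ (f , cong suc (sym (ℕ.+-suc f (f ℕ.+ 0))))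
  ... | inj₂ (f , p)    = inj₁ (suc f , p)
... | inj₁ (f , refl) = f , 2 ℕ.^ suc d , ℕ.*-comm (odd f) (2 ℕ.^ suc d)
... | inj₂ (f , p) with odd-part d f (ℕ.*-cancelˡ-≤ 2 (subst (_≤ 2 ℕ.^ suc d) p b<2^d))
... | e , c , q = e , c , (begin
  odd e ℕ.* (2 ℕ.* 2 ℕ.^ d) ≡⟨ solve 2 (λ a b → a :* (con 2 :* b) := con 2 :* (a :* b)) refl (odd e) (2 ℕ.^ d) ⟩
  2 ℕ.* (odd e ℕ.* 2 ℕ.^ d) ≡⟨ cong (2 ℕ.*_) q ⟩
  2 ℕ.* (c ℕ.* suc f)       ≡⟨ solve 2 (λ a b → con 2 :* (a :* b) := a :* (con 2 :* b)) refl c (suc f) ⟩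
  c ℕ.* (2 ℕ.* suc f)       ≡⟨ cong (c ℕ.*_) p ⟨
  c ℕ.* suc b               ∎)
  where open ≡-Reasoning; open ℕ.+-*-Solver

fraction-twoAdic : ∀ d {x} → FractionUpTo (2 ℕ.^ d) x → TwoAdic d 0 x
fraction-twoAdic d {x} (a , b , _ , b<2^d , refl) with odd-part d b b<2^d
... | e , c , p = e , + c ℤ.* + a , (begin
  ι (+ odd e) ⊛ (ι (2^ d) ⊛ x)       ≡⟨ ℚ.*-assoc (ι (+ odd e)) (ι (2^ d)) x ⟨
  ι (+ odd e) ⊛ ι (2^ d) ⊛ x         ≡⟨ cong (_⊛ x) (ι-⊛ (+ odd e) (2^ d)) ⟨
  ι (+ odd e ℤ.* 2^ d) ⊛ x           ≡⟨ cong (λ t → ι t ⊛ x) (trans (sym (ℤ.pos-* (odd e) (2 ℕ.^ d))) (trans (cong +_ p) (ℤ.pos-* c (suc b)))) ⟩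
  ι (+ c ℤ.* + suc b) ⊛ x            ≡⟨ cong (_⊛ x) (ι-⊛ (+ c) (+ suc b)) ⟩
  ι (+ c) ⊛ ι (+ suc b) ⊛ x          ≡⟨ ℚ.*-assoc (ι (+ c)) (ι (+ suc b)) x ⟩
  ι (+ c) ⊛ (ι (+ suc b) ⊛ x)        ≡⟨ cong (ι (+ c) ⊛_) (ι-/ (+ a) b) ⟩
  ι (+ c) ⊛ ι (+ a)                  ≡⟨ ι-⊛ (+ c) (+ a) ⟨
  ι (+ c ℤ.* + a)                    ≡⟨ cong ι (ℤ.*-identityˡ (+ c ℤ.* + a)) ⟨
  ι (2^ 0 ℤ.* (+ c ℤ.* + a))         ∎)
  where open ≡-Reasoning

1∈TwoAdic : ∀ d → TwoAdic d 0 1ℚ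
1∈TwoAdic d = fraction-twoAdic d (1 , 0 , ℕ.m^n>0 2 d , ℕ.m^n>0 2 d , refl)

-- The dimension `suc d` is what makes this work: its `d + 1` doublings outnumber the at most `d`
-- factors of two in a denominator.
no-deficit-pattern : ∀ d r (v : Fin (suc d) → Vec ℕ (suc d) → ℚ) → let q = r ℕ.* 2 in
  (∀ i τ → All (_≤ q) τ → FractionUpTo (2 ℕ.^ d) (v i τ)) →
  (∀ i τ → All (_≤ q) τ → lookup τ i ≡ q → v i τ ≡ back i (v i) τ) →
  ¬ (∀ i τ → All (_≤ q) τ → lookup τ i ≡ q → load v τ ≡ 1ℚ)
no-deficit-pattern d r v frac periodic sat = sgn∉TwoAdic d (suc d)
  (deficit-obstruction (twoAdic-filtration d) r v (1∈TwoAdic d)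
    (λ i τ τ≤q → fraction-twoAdic d (frac i τ τ≤q)) periodic sat)

-- Shift graphs

-- `p` twos with `C` on top. The accumulator form matches the induction on the shift graph, where
-- `C` colours become `2 ^ C` sets of colours.
tow : ℕ → ℕ → ℕ
tow zero    C = C
tow (suc p) C = tow p (2 ^ C)

Increasing : ∀ {m p} → Vec (Fin m) p → Set
Increasing []           = ⊤
Increasing (x ∷ [])     = ⊤
Increasing (x ∷ y ∷ ys) = x Fin.< y × Increasing (y ∷ ys)

increasing? : ∀ {m p} (x : Vec (Fin m) p) → Dec (Increasing x)
increasing? []           = yes tt
increasing? (x ∷ [])     = yes tt
increasing? (x ∷ y ∷ ys) = (x Fin.<? y) ×-dec increasing? (y ∷ ys)

front : ∀ {A : Set} {p} → Vec A (suc p) → Vec A p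
front {p = zero}  _        = []
front {p = suc p} (x ∷ xs) = x ∷ front xs

funToFin-injective : ∀ {m n} {f g : Fin m → Fin n} → funToFin f ≡ funToFin g → ∀ i → f i ≡ g i
funToFin-injective {f = f} {g} e i =
  trans (sym (Fin.finToFun-funToFin f i))
        (trans (cong (λ t → finToFun t i) e) (Fin.finToFun-funToFin g i))

bit : Bool → Fin 2
bit false = zero
bit true  = suc zero

bit-injective : ∀ {b c} → bit b ≡ bit c → b ≡ c
bit-injective {false} {false} _ = refl
bit-injective {true}  {true}  _ = refl

does-true : ∀ {P : Set} (P? : Dec P) → does P? ≡ true → P
does-true (yes p) _ = p

-- The shift graph on increasing (p + 1)-tuples is not C-colourable: a colouring
-- F of tuples yields the colouring of shorter tuples x by { F (a ∷ x) | a < x₀ }.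
shift-graph : ∀ {m} p C → tow p C < m → (F : Vec (Fin m) (suc p) → Fin C) →
              ∃ λ (z : Vec (Fin m) (2+ p)) → Increasing z × F (front z) ≡ F (tail z)
shift-graph zero C C<m F with Fin.pigeonhole C<m (λ i → F (i ∷ []))
... | i , j , i<j , e = i ∷ j ∷ [] , (i<j , tt) , e
shift-graph {m} (suc p) C tow<m F = extend (shift-graph p (2 ^ C) tow<m (funToFin ∘ S))
  where
  below? : ∀ x c → Dec (∃ λ a → a Fin.< head x × F (a ∷ x) ≡ c)
  below? x c = Fin.any? λ a → (a Fin.<? head x) ×-dec (F (a ∷ x) Fin.≟ c)
  S : Vec (Fin m) (suc p) → Fin C → Fin 2
  S x c = bit (does (below? x c))
  extend : (∃ λ z → Increasing z × funToFin (S (front z)) ≡ funToFin (S (tail z))) →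
           ∃ λ z → Increasing z × F (front z) ≡ F (tail z)
  -- The colour `F (x ∷ y ∷ ys)` belongs to the set of `y ∷ ys`, witnessed by `x`. The sets of the
  -- two windows coincide, so it also belongs to that of `x ∷ front (y ∷ ys)`, which supplies the
  -- new first letter `a`.
  extend (x ∷ y ∷ ys , (x<y , inc) , e)
    with does-true (below? (x ∷ front (y ∷ ys)) (F (x ∷ y ∷ ys)))
           (trans (bit-injective (funToFin-injective e (F (x ∷ y ∷ ys))))
                  (dec-true (below? (y ∷ ys) (F (x ∷ y ∷ ys))) (x , x<y , refl)))
  ... | a , a<x , Fa≡Fx = a ∷ x ∷ y ∷ ys , (a<x , x<y , inc) , Fa≡Fx

-- Every sequence loses one letter: the first on axis `j`, the last on the other axes. The result
-- has the same shape as `map front Z`, translated by one step along axis `j`.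
shiftAt : ∀ {A : Set} {p k} → Fin k → Vec (Vec A (suc p)) k → Vec (Vec A p) k
shiftAt zero    (z ∷ Z) = tail z ∷ map front Z
shiftAt (suc j) (z ∷ Z) = front z ∷ shiftAt j Z

-- The first operand is the alphabet that suffices for the first axis. The second treats the other
-- axes, with as many colours as there are tables over the words in that alphabet.
threshold : ℕ → ℕ → ℕ → ℕ
threshold p zero    C = 0
threshold p (suc k) C = suc (tow p C) ⊔ threshold p k (C ^ (suc (tow p C) ^ suc p))

map-increasing : ∀ {l m p} (l≤m : l ≤ m) (x : Vec (Fin l) p) →
                 Increasing x → Increasing (map (λ i → inject≤ i l≤m) x)
map-increasing l≤m []           _ = tt
map-increasing l≤m (x ∷ [])     _ = tt
map-increasing l≤m (x ∷ y ∷ ys) (x<y , inc) =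
  subst₂ _<_ (sym (Fin.toℕ-inject≤ x l≤m)) (sym (Fin.toℕ-inject≤ y l≤m)) x<y ,
  map-increasing l≤m (y ∷ ys) inc

front-map : ∀ {A B : Set} {p} (f : A → B) (x : Vec A (suc p)) → front (map f x) ≡ map f (front x)
front-map {p = zero}  f (x ∷ []) = refl
front-map {p = suc p} f (x ∷ xs) = cong (f x ∷_) (front-map f xs)

tail-map : ∀ {A B : Set} {p} (f : A → B) (x : Vec A (suc p)) → tail (map f x) ≡ map f (tail x)
tail-map f (x ∷ xs) = refl

-- The first sequence is taken from a small alphabet, so that the table of F
-- over all its values is itself a colouring of the remaining sequences.
shift-invariant : ∀ p k C m → threshold p k C ≤ m →
  (F : Vec (Vec (Fin m) (suc p)) k → Fin C) →
  ∃ λ (Z : Vec (Vec (Fin m) (2+ p)) k) →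
    All Increasing Z × (∀ j → F (map front Z) ≡ F (shiftAt j Z))
shift-invariant p zero    C m _     F = [] , [] , λ ()
shift-invariant p (suc k) C m thr≤m F =
  -- Equal tables give invariance for all words of the first axis over the small alphabet at once,
  -- so `z` can be chosen after `Z`.
  let Z , incs , inv = shift-invariant p k (C ^ (l ^ suc p)) m (ℕ.m⊔n≤o⇒n≤o l _ thr≤m) table
      z , inc , e    = shift-graph p C ℕ.≤-refl (λ x → F (map emb x ∷ map front Z))
  in map emb z ∷ Z , map-increasing l≤m z inc ∷ incs , λ where
    zero    → trans (cong (λ x → F (x ∷ map front Z)) (front-map emb z))
                    (trans e (cong (λ x → F (x ∷ map front Z)) (sym (tail-map emb z))))
    (suc j) → subst (λ x → F (x ∷ map front Z) ≡ F (x ∷ shiftAt j Z))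
                    (sym (front-map emb z)) (untable (map front Z) (shiftAt j Z) (inv j) (front z))
  where
  l = suc (tow p C)
  l≤m : l ≤ m
  l≤m = ℕ.m⊔n≤o⇒m≤o l (threshold p k (C ^ (l ^ suc p))) thr≤m
  emb : Fin l → Fin m
  emb i = inject≤ i l≤m
  table : Vec (Vec (Fin m) (suc p)) k → Fin (C ^ (l ^ suc p))
  table Y = funToFin λ t → F (map emb (tabulate (finToFun t)) ∷ Y)
  untable : ∀ Y Y′ → table Y ≡ table Y′ → ∀ x → F (map emb x ∷ Y) ≡ F (map emb x ∷ Y′)
  untable Y Y′ e x = subst (λ x → F (map emb x ∷ Y) ≡ F (map emb x ∷ Y′))
    (trans (Vec.tabulate-cong (Fin.finToFun-funToFin (lookup x))) (Vec.tabulate∘lookup x))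
    (funToFin-injective e (funToFin (lookup x)))

-- Growth

tower : ℕ → ℕ
tower zero    = 1
tower (suc h) = 2 ^ tower h

n<tower : ∀ n → n < tower n
n<tower zero    = s≤s z≤n
n<tower (suc n) = ℕ.≤-<-trans (n<tower n) (n<2^n (tower n))

tower-suc : ∀ h → tower h ≤ tower (suc h)
tower-suc h = ℕ.<⇒≤ (n<2^n (tower h))

tower-mono : ∀ {g h} → g ≤ h → tower g ≤ tower h
tower-mono {h = zero}  z≤n       = ℕ.≤-refl
tower-mono {h = suc h} z≤n       = ℕ.≤-trans (tower-mono {h = h} z≤n) (tower-suc h)
tower-mono             (s≤s g≤h) = ℕ.^-monoʳ-≤ 2 (tower-mono g≤h)

log*-tower : ∀ h {n} → n ≤ tower h → log* n ≤ h
log*-tower h {n} = go h n (<-wellFounded n)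
  where
  go : ∀ h n (a : Acc _<_ n) → n ≤ tower h → log*-acc n a ≤ h
  go h       0      _        _   = z≤n
  go h       1      _        _   = z≤n
  go zero    (2+ n) _        (s≤s ())
  go (suc h) (2+ n) (acc rs) n≤t = s≤s (go h _ (rs (⌈log₂2+n⌉<2+n n))
    (ℕ.≤-trans (⌈log₂⌉-mono-≤ n≤t) (ℕ.≤-reflexive (⌈log₂2^n⌉≡n (tower h)))))

2*n≤2^n : ∀ {n} → 1 ≤ n → 2 * n ≤ 2 ^ n
2*n≤2^n {suc n} _ = ℕ.*-monoʳ-≤ 2 (n<2^n n)

tower-square : ∀ h → tower h * tower h ≤ tower (suc h)
tower-square zero    = s≤s z≤n
tower-square (suc h) = begin
  2 ^ tower h * 2 ^ tower h   ≡⟨ ℕ.^-distribˡ-+-* 2 (tower h) (tower h) ⟨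
  2 ^ (tower h + tower h)     ≡⟨ cong (λ t → 2 ^ (tower h + t)) (ℕ.+-identityʳ (tower h)) ⟨
  2 ^ (2 * tower h)           ≤⟨ ℕ.^-monoʳ-≤ 2 (2*n≤2^n (tower-mono {0} {h} z≤n)) ⟩
  2 ^ 2 ^ tower h             ∎
  where open ℕ.≤-Reasoning

-- `x ^ y` is at most `2 ^ (tower h * tower h)`: one level pays for the square and one for the
-- exponential.
tower-^ : ∀ {x y} h → x ≤ tower h → y ≤ tower h → x ^ y ≤ tower (2 + h)
tower-^ {x} {y} h x≤ y≤ = begin
  x ^ y                      ≤⟨ ℕ.^-monoˡ-≤ y (ℕ.≤-trans x≤ (tower-suc h)) ⟩
  (2 ^ tower h) ^ y          ≤⟨ ℕ.^-monoʳ-≤ (2 ^ tower h) {{ℕ.m^n≢0 2 (tower h)}} y≤ ⟩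
  (2 ^ tower h) ^ tower h    ≡⟨ ℕ.^-*-assoc 2 (tower h) (tower h) ⟩
  2 ^ (tower h * tower h)    ≤⟨ ℕ.^-monoʳ-≤ 2 (tower-square h) ⟩
  tower (2 + h)              ∎
  where open ℕ.≤-Reasoning

tow-tower : ∀ p {C} h → C ≤ tower h → tow p C ≤ tower (p + h)
tow-tower zero    h C≤ = C≤
tow-tower (suc p) h C≤ = ℕ.≤-trans (tow-tower p (suc h) (ℕ.^-monoʳ-≤ 2 C≤))
                                   (ℕ.≤-reflexive (cong tower (ℕ.+-suc p h)))

-- One axis costs `5 + p` levels: `p + 1` for the alphabet size `suc (tow p C)`, and two for each of
-- the two nested powers in the number of tables. For fixed `k` the height is therefore linear in
-- `p`.
threshold-tower : ∀ p k {C} h → C ≤ tower h → threshold p k C ≤ tower (k * (5 + p) + h)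
threshold-tower p zero    h C≤ = z≤n
threshold-tower p (suc k) {C} h C≤ = ℕ.⊔-lub
  (ℕ.≤-trans l≤ (tower-mono (begin
    suc (p + h)                           ≤⟨ ℕ.+-monoˡ-≤ h (ℕ.m≤n+m (suc p) 4) ⟩
    5 + p + h                             ≤⟨ ℕ.+-monoˡ-≤ h (ℕ.m≤m+n (5 + p) (k * (5 + p))) ⟩
    5 + p + k * (5 + p) + h               ∎)))
  (ℕ.≤-trans (threshold-tower p k (4 + suc (p + h)) (tower-^ (2 + suc (p + h)) (up (3 + p) C≤)
                (tower-^ (suc (p + h)) l≤ (ℕ.≤-trans (ℕ.m≤m+n (suc p) h) (ℕ.<⇒≤ (n<tower (suc (p + h))))))))
             (ℕ.≤-reflexive (cong tower (solve 3 (λ p k h → k :* (con 5 :+ p) :+ (con 5 :+ (p :+ h)) :=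
                                              (con 5 :+ p :+ k :* (con 5 :+ p)) :+ h) refl p k h))))
  where
  open ℕ.≤-Reasoning
  open ℕ.+-*-Solver
  up : ∀ {x} g → x ≤ tower h → x ≤ tower (g + h)
  up g x≤ = ℕ.≤-trans x≤ (tower-mono (ℕ.m≤n+m h g))
  l≤ : suc (tow p C) ≤ tower (suc (p + h))
  l≤ = ℕ.≤-<-trans (tow-tower p h C≤) (n<2^n (tower (p + h)))

-- The number of ways to give each of `k` axes and `B ^ k` positions one of `W` colours.
patterns : ℕ → ℕ → ℕ → ℕ
patterns W k B = (W ^ (B ^ k)) ^ k

patterns-tower : ∀ W k B → patterns W k B ≤ tower (6 + (W + k + B))
patterns-tower W k B =
  tower-^ (4 + s) (tower-^ (2 + s) (≤tower 2 W (ℕ.m≤m+n W k)) (tower-^ s (≤s B (ℕ.m≤n+m B (W + k))) (≤s k k≤)))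
          (≤tower 4 k (ℕ.m≤n+m k W))
  where
  s = W + k + B
  k≤ : k ≤ s
  k≤ = ℕ.≤-trans (ℕ.m≤n+m k W) (ℕ.m≤m+n (W + k) B)
  ≤s : ∀ x → x ≤ s → x ≤ tower s
  ≤s x x≤s = ℕ.≤-trans x≤s (ℕ.<⇒≤ (n<tower s))
  ≤tower : ∀ g x → x ≤ W + k → x ≤ tower (g + s)
  ≤tower g x x≤ = ℕ.≤-trans (≤s x (ℕ.≤-trans x≤ (ℕ.m≤m+n (W + k) B))) (tower-mono (ℕ.m≤n+m s g))

-- The side length of the grid is 5 + 3 T (m ^ k).
room : ∀ W k (T : ℕ → ℕ) → 1 ≤ k → T ∈o log* →
  ∃ λ m → let t = T (m ^ k) in
    threshold (4 + 3 * t) k (patterns W k (5 + 3 * t)) ≤ m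
-- The threshold itself depends on `t = T (m ^ k)`. It is below a tower of height
-- `3 * (1 + k) * t + c₀`; asking `o` for twice this coefficient confines the part with `t` to half
-- of `2 + h`.
room W k T 1≤k o with o (6 * (1 + k))
... | n₀ , small = m , (begin
  threshold p k (patterns W k (suc p))
    ≤⟨ threshold-tower p k (6 + (W + k + suc p)) (patterns-tower W k (suc p)) ⟩
  tower (k * (5 + p) + (6 + (W + k + suc p)))
    ≤⟨ tower-mono fits ⟩
  m ∎)
  where
  open ℕ.≤-Reasoning
  open ℕ.+-*-Solver
  c₀ = 11 + W + 10 * k
  -- `n₀` makes `m ^ k` large enough for `o`, and `2 * suc c₀` absorbs the additive terms. It also
  -- gives `k ≤ tower h`, hence `log* (m ^ k) ≤ 2 + h`.
  h = n₀ + 2 * suc c₀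
  m = tower h
  n = m ^ k
  t = T n
  p = 4 + 3 * t
  instance
    m≢0 : ℕ.NonZero m
    m≢0 = ℕ.>-nonZero (tower-mono {0} {h} z≤n)
  m≤n : m ≤ n
  m≤n = ℕ.≤-trans (ℕ.≤-reflexive (sym (ℕ.^-identityʳ m))) (ℕ.^-monoʳ-≤ m {1} {k} 1≤k)
  h≤m : h ≤ m
  h≤m = ℕ.<⇒≤ (n<tower h)
  k≤c₀ : k ≤ c₀
  k≤c₀ = ℕ.≤-trans (ℕ.m≤m+n k (9 * k)) (ℕ.m≤n+m (10 * k) (11 + W))
  c₀≤h : c₀ ≤ h
  c₀≤h = ℕ.≤-trans (ℕ.n≤1+n c₀) (ℕ.≤-trans (ℕ.m≤m+n (suc c₀) _) (ℕ.m≤n+m (2 * suc c₀) n₀))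
  t-bound : 6 * (1 + k) * t ≤ 2 + h
  t-bound = ℕ.≤-trans (small n (ℕ.≤-trans (ℕ.m≤m+n n₀ _) (ℕ.≤-trans h≤m m≤n)))
    (log*-tower (2 + h) (tower-^ h ℕ.≤-refl (ℕ.≤-trans k≤c₀ (ℕ.≤-trans c₀≤h h≤m))))
  fits : k * (5 + p) + (6 + (W + k + suc p)) ≤ h
  fits = ℕ.*-cancelˡ-≤ 2 (begin
    2 * (k * (5 + p) + (6 + (W + k + suc p)))
      ≡⟨ solve 3 (λ k t W → con 2 :* (k :* (con 9 :+ con 3 :* t) :+ (con 6 :+ (W :+ k :+ (con 5 :+ con 3 :* t)))) :=
             con 6 :* (con 1 :+ k) :* t :+ con 2 :* (con 11 :+ W :+ con 10 :* k)) refl k t W ⟩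
    6 * (1 + k) * t + 2 * c₀
      ≤⟨ ℕ.+-monoˡ-≤ (2 * c₀) t-bound ⟩
    2 + h + 2 * c₀
      ≡⟨ solve 2 (λ h c → con 2 :+ h :+ con 2 :* c := h :+ con 2 :* (con 1 :+ c)) refl h c₀ ⟩
    h + 2 * suc c₀
      ≤⟨ ℕ.+-monoʳ-≤ h (ℕ.m≤n+m (2 * suc c₀) n₀) ⟩
    h + h
      ≡⟨ cong (λ x → h + x) (ℕ.+-identityʳ h) ⟨
    2 * h ∎)

-- Cardinality of subsets covered by a list

∣p∪q∣≤∣p∣+∣q∣ : ∀ {n} (p q : Subset n) → ∣ p ∪ q ∣ ≤ ∣ p ∣ + ∣ q ∣
∣p∪q∣≤∣p∣+∣q∣ []            []            = z≤n
∣p∪q∣≤∣p∣+∣q∣ (outside ∷ p) (outside ∷ q) = ∣p∪q∣≤∣p∣+∣q∣ p q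
∣p∪q∣≤∣p∣+∣q∣ (inside ∷ p)  (outside ∷ q) = s≤s (∣p∪q∣≤∣p∣+∣q∣ p q)
∣p∪q∣≤∣p∣+∣q∣ (outside ∷ p) (inside ∷ q)  =
  ℕ.≤-trans (s≤s (∣p∪q∣≤∣p∣+∣q∣ p q)) (ℕ.≤-reflexive (sym (ℕ.+-suc ∣ p ∣ ∣ q ∣)))
∣p∪q∣≤∣p∣+∣q∣ (inside ∷ p)  (inside ∷ q)  =
  s≤s (ℕ.≤-trans (∣p∪q∣≤∣p∣+∣q∣ p q) (ℕ.+-monoʳ-≤ ∣ p ∣ (ℕ.n≤1+n ∣ q ∣)))

covered-card : ∀ {n} {A : Set} (g : A → Maybe (Fin n)) (l : List A) (S : Subset n) →
               (∀ {u} → u ∈ S → ∃ λ δ → δ ∈ˡ l × g δ ≡ just u) → ∣ S ∣ ≤ length l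
covered-card {n} {A} g l S cov = ℕ.≤-trans (p⊆q⇒∣p∣≤∣q∣ S⊆cover) (card l)
  where
  point : Maybe (Fin n) → Subset n
  point = maybe′ ⁅_⁆ ∅
  cover : List A → Subset n
  cover []      = ∅
  cover (δ ∷ l) = point (g δ) ∪ cover l
  card-point : ∀ w → ∣ point w ∣ ≤ 1
  card-point (just w) = ℕ.≤-reflexive (∣⁅x⁆∣≡1 w)
  card-point nothing  = ℕ.≤-trans (ℕ.≤-reflexive (∣⊥∣≡0 n)) z≤n
  card : ∀ l → ∣ cover l ∣ ≤ length l
  card []      = ℕ.≤-reflexive (∣⊥∣≡0 n)
  card (δ ∷ l) = ℕ.≤-trans (∣p∪q∣≤∣p∣+∣q∣ (point (g δ)) (cover l)) (ℕ.+-mono-≤ (card-point (g δ)) (card l))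
  ∈cover : ∀ {u δ} l → δ ∈ˡ l → g δ ≡ just u → u ∈ cover l
  ∈cover {u} (δ ∷ l) (here refl) e = x∈p∪q⁺ {p = point (g δ)} {q = cover l} (inj₁ (subst (λ w → u ∈ point w) (sym e) (x∈⁅x⁆ u)))
  ∈cover     (δ ∷ l) (there δ∈l) e = x∈p∪q⁺ {p = point (g δ)} {q = cover l} (inj₂ (∈cover l δ∈l e))
  S⊆cover : ∀ {u} → u ∈ S → u ∈ cover l
  S⊆cover u∈S = let δ , δ∈l , e = cov u∈S in ∈cover l δ∈l e

-- Finite sums

Σℚ-cong : ∀ {A : Set} (l : List A) {f g : A → ℚ} → (∀ i → f i ≡ g i) → Σℚ l f ≡ Σℚ l g
Σℚ-cong []      e = refl
Σℚ-cong (i ∷ l) e = cong₂ _⊕_ (e i) (Σℚ-cong l e)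

Σℚ-++ : ∀ {A : Set} (l m : List A) {f : A → ℚ} → Σℚ (l ++ m) f ≡ Σℚ l f ⊕ Σℚ m f
Σℚ-++ []      m {f} = sym (ℚ.+-identityˡ (Σℚ m f))
Σℚ-++ (i ∷ l) m {f} = trans (cong (f i ⊕_) (Σℚ-++ l m)) (sym (ℚ.+-assoc (f i) (Σℚ l f) (Σℚ m f)))

Σℚ-map : ∀ {A B : Set} (h : A → B) (l : List A) {f : B → ℚ} → Σℚ (List.map h l) f ≡ Σℚ l (λ i → f (h i))
Σℚ-map h []          = refl
Σℚ-map h (i ∷ l) {f} = cong (f (h i) ⊕_) (Σℚ-map h l)

Σℚ-⊕ : ∀ {A : Set} (l : List A) {f g : A → ℚ} → Σℚ l (λ i → f i ⊕ g i) ≡ Σℚ l f ⊕ Σℚ l g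
Σℚ-⊕ []              = refl
Σℚ-⊕ (i ∷ l) {f} {g} = trans (cong ((f i ⊕ g i) ⊕_) (Σℚ-⊕ l))
  (solve 4 (λ a b c d → (a :+ b) :+ (c :+ d) := (a :+ c) :+ (b :+ d)) refl (f i) (g i) (Σℚ l f) (Σℚ l g))
  where open +-*-Solver

sum-point : ∀ {n} (w : Fin n) (x : ℚ) → sum (λ u → if does (w Fin.≟ u) then x else 0ℚ) ≡ x
sum-point {suc n} zero    x = trans (cong (x ⊕_) (sum-replicate-zero n)) (ℚ.+-identityʳ x)
sum-point {suc n} (suc w) x = trans (cong (0ℚ ⊕_) (sum-point w x)) (ℚ.+-identityˡ x)

sum-Σℚ : ∀ {n} {A : Set} (l : List A) (h : A → Fin n → ℚ) →
         sum (λ u → Σℚ l (λ δ → h δ u)) ≡ Σℚ l (λ δ → sum (h δ))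
sum-Σℚ {n} []      h = sum-replicate-zero n
sum-Σℚ     (δ ∷ l) h = trans (∑-distrib-+ (h δ) (λ u → Σℚ l (λ δ → h δ u))) (cong (sum (h δ) ⊕_) (sum-Σℚ l h))

module _ {n : ℕ} {A : Set} (g : A → Maybe (Fin n)) (f : Fin n → ℚ)
         (g-injective : ∀ {δ ε u} → g δ ≡ just u → g ε ≡ just u → δ ≡ ε) where

  private
    at-point : Fin n → Maybe (Fin n) → ℚ
    at-point u = maybe′ (λ w → if does (w Fin.≟ u) then f w else 0ℚ) 0ℚ

    at-point-≢ : ∀ {u} w → w ≢ just u → at-point u w ≡ 0ℚ
    at-point-≢     nothing  _ = refl
    at-point-≢ {u} (just w) w≢u with w Fin.≟ u
    ... | yes refl = contradiction refl w≢u
    ... | no  _    = refl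

    at-point-≡ : ∀ u → at-point u (just u) ≡ f u
    at-point-≡ u with u Fin.≟ u
    ... | yes _  = refl
    ... | no u≢u = contradiction refl u≢u

    miss : ∀ {u} l → (∀ {δ} → δ ∈ˡ l → g δ ≢ just u) → Σℚ l (λ δ → at-point u (g δ)) ≡ 0ℚ
    miss []      _ = refl
    miss (δ ∷ l) h = trans (cong₂ _⊕_ (at-point-≢ (g δ) (h (here refl))) (miss l (h ∘ there))) (ℚ.+-identityˡ 0ℚ)

    hit : ∀ {u δ} l → Unique l → δ ∈ˡ l → g δ ≡ just u → Σℚ l (λ δ → at-point u (g δ)) ≡ f u
    hit {u} (δ ∷ l) (δ∉l ∷ _) (here refl) e = trans
      (cong₂ _⊕_ (trans (cong (at-point u) e) (at-point-≡ u))
                 (miss l λ ε∈l e′ → Allˡ.lookup δ∉l ε∈l (g-injective e e′)))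
      (ℚ.+-identityʳ (f u))
    hit {u} (ε ∷ l) (ε∉l ∷ l!) (there δ∈l) e = trans
      (cong₂ _⊕_ (at-point-≢ (g ε) λ e′ → Allˡ.lookup ε∉l δ∈l (g-injective e′ e)) (hit l l! δ∈l e))
      (ℚ.+-identityˡ (f u))

  -- Turns the sum over all nodes that defines `x[v]` into a sum over directions. Both sides expand
  -- into indicators `at-point`; by uniqueness of `l` and injectivity of `g`, each element of `S` is
  -- hit exactly once.
  sum-over-image : ∀ (S : Subset n) l → Unique l →
    (∀ {u} → u ∈ S → ∃ λ δ → δ ∈ˡ l × g δ ≡ just u) →
    (∀ {u δ} → δ ∈ˡ l → g δ ≡ just u → u ∈ S) →
    sum (λ u → if does (u ∈? S) then f u else 0ℚ) ≡ Σℚ l (λ δ → maybe′ f 0ℚ (g δ))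
  sum-over-image S l l! cov sound = begin
    sum (λ u → if does (u ∈? S) then f u else 0ℚ)
      ≡⟨ sum-cong-≗ pointwise ⟩
    sum (λ u → Σℚ l (λ δ → at-point u (g δ)))
      ≡⟨ sum-Σℚ l (λ δ u → at-point u (g δ)) ⟩
    Σℚ l (λ δ → sum (λ u → at-point u (g δ)))
      ≡⟨ Σℚ-cong l (λ δ → total (g δ)) ⟩
    Σℚ l (λ δ → maybe′ f 0ℚ (g δ)) ∎
    where
    open ≡-Reasoning
    total : ∀ w → sum (λ u → at-point u w) ≡ maybe′ f 0ℚ w
    total (just w) = sum-point w (f w)
    total nothing  = sum-replicate-zero n
    pointwise : ∀ u → (if does (u ∈? S) then f u else 0ℚ) ≡ Σℚ l (λ δ → at-point u (g δ))
    pointwise u with u ∈? S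
    ... | yes u∈S = let δ , δ∈l , e = cov u∈S in sym (hit l l! δ∈l e)
    ... | no  u∉S = sym (miss l λ δ∈l e → u∉S (sound δ∈l e))

-- Steps in the grid

Direction : ℕ → Set
Direction k = Fin k ⊎ Fin k

directions : ∀ k → List (Direction k)
directions k = List.map inj₁ (allFin k) ++ List.map inj₂ (allFin k)

move : ∀ {k} → Direction k → Vec ℕ k → Maybe (Vec ℕ k)
move (inj₁ i) τ = just (inc i τ)
move (inj₂ i) τ = dec? i τ

inj₁≢inj₂ : ∀ {A B : Set} {a : A} {b : B} → inj₁ a ≢ inj₂ b
inj₁≢inj₂ ()

directions-unique : ∀ k → Unique (directions k)
directions-unique k = Unique.++⁺
  (Unique.map⁺ (λ where refl → refl) (Unique.allFin⁺ k))
  (Unique.map⁺ (λ where refl → refl) (Unique.allFin⁺ k))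
  λ (p , q) → let _ , _ , e = ∈ˡ.∈-map⁻ inj₁ p ; _ , _ , e′ = ∈ˡ.∈-map⁻ inj₂ q
              in inj₁≢inj₂ (trans (sym e) e′)

∈-directions : ∀ {k} (δ : Direction k) → δ ∈ˡ directions k
∈-directions (inj₁ i) = ∈ˡ.∈-++⁺ˡ (∈ˡ.∈-map⁺ inj₁ (∈ˡ.∈-allFin i))
∈-directions {k} (inj₂ i) = ∈ˡ.∈-++⁺ʳ (List.map inj₁ (allFin k)) (∈ˡ.∈-map⁺ inj₂ (∈ˡ.∈-allFin i))

length-directions : ∀ k → length (directions k) ≡ k + k
length-directions k = trans (List.length-++ (List.map inj₁ (allFin k)))
  (cong₂ _+_ (len inj₁) (len inj₂))
  where
  len : (f : Fin k → Direction k) → length (List.map f (allFin k)) ≡ k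
  len f = trans (List.length-map f (allFin k)) (List.length-tabulate _)

dec?-inc : ∀ {k} (i : Fin k) τ → dec? i (inc i τ) ≡ just τ
dec?-inc zero    (b ∷ τ) = refl
dec?-inc (suc i) (b ∷ τ) = cong (Maybe.map (b ∷_)) (dec?-inc i τ)

inc-dec? : ∀ {k} (i : Fin k) τ {σ} → dec? i τ ≡ just σ → τ ≡ inc i σ
inc-dec? zero    (suc b ∷ τ) refl = refl
inc-dec? (suc i) (b ∷ τ) e with dec? i τ in e′
inc-dec? (suc i) (b ∷ τ) refl | just σ = cong (b ∷_) (inc-dec? i τ e′)

dec?-pos : ∀ {k} (i : Fin k) τ → 0 < lookup τ i → ∃ λ σ → dec? i τ ≡ just σ
dec?-pos zero    (suc b ∷ τ) _ = b ∷ τ , refl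
dec?-pos (suc i) (b ∷ τ) 0<τᵢ = let σ , e = dec?-pos i τ 0<τᵢ in b ∷ σ , cong (Maybe.map (b ∷_)) e

inc-lookup : ∀ {k} (i : Fin k) τ → lookup (inc i τ) i ≡ suc (lookup τ i)
inc-lookup zero    (b ∷ τ) = refl
inc-lookup (suc i) (b ∷ τ) = inc-lookup i τ

inc-lookup-≢ : ∀ {k} {i j : Fin k} τ → i ≢ j → lookup (inc i τ) j ≡ lookup τ j
inc-lookup-≢ {i = zero}  {zero}  τ       i≢j = contradiction refl i≢j
inc-lookup-≢ {i = zero}  {suc j} (b ∷ τ) i≢j = refl
inc-lookup-≢ {i = suc i} {zero}  (b ∷ τ) i≢j = refl
inc-lookup-≢ {i = suc i} {suc j} (b ∷ τ) i≢j = inc-lookup-≢ τ (i≢j ∘ cong suc)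

inc-comm : ∀ {k} (i j : Fin k) τ → inc i (inc j τ) ≡ inc j (inc i τ)
inc-comm zero    zero    (b ∷ τ) = refl
inc-comm zero    (suc j) (b ∷ τ) = refl
inc-comm (suc i) zero    (b ∷ τ) = refl
inc-comm (suc i) (suc j) (b ∷ τ) = cong (b ∷_) (inc-comm i j τ)

inc-injective : ∀ {k} (i : Fin k) {τ σ} → inc i τ ≡ inc i σ → τ ≡ σ
inc-injective i {τ} {σ} e = Maybe.just-injective
  (trans (sym (dec?-inc i τ)) (trans (cong (dec? i) e) (dec?-inc i σ)))

inc-axis-injective : ∀ {k} (i j : Fin k) {τ} → inc i τ ≡ inc j τ → i ≡ j
inc-axis-injective i j {τ} e with i Fin.≟ j
... | yes i≡j = i≡j
... | no  i≢j = contradiction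
  (trans (sym (inc-lookup i τ)) (trans (cong (λ σ → lookup σ i) e) (inc-lookup-≢ τ (i≢j ∘ sym))))
  ℕ.1+n≢n

-- Coordinate `i` of `τ` is unaffected by `inc j`, so it is positive and can be lowered to give the
-- fourth corner `ρ`.
inc-diamond : ∀ {k} (i j : Fin k) {τ σ} → i ≢ j → inc j τ ≡ inc i σ → ∃ λ ρ → τ ≡ inc i ρ × σ ≡ inc j ρ
inc-diamond i j {τ} {σ} i≢j e = ρ , τ≡ , inc-injective i (trans (sym e) (trans (cong (inc j) τ≡) (inc-comm j i ρ)))
  where
  pos : 0 < lookup τ i
  pos = subst (0 <_) (trans (sym (inc-lookup i σ)) (trans (cong (λ x → lookup x i) (sym e)) (inc-lookup-≢ τ (i≢j ∘ sym)))) (s≤s z≤n)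
  ρ = proj₁ (dec?-pos i τ pos)
  τ≡ = inc-dec? i τ (proj₂ (dec?-pos i τ pos))

weight : ∀ {k} → Vec ℕ k → ℕ
weight []      = 0
weight (b ∷ τ) = b + weight τ

weight-inc : ∀ {k} (i : Fin k) τ → weight (inc i τ) ≡ suc (weight τ)
weight-inc zero    (b ∷ τ) = refl
weight-inc (suc i) (b ∷ τ) = trans (cong (λ w → b + w) (weight-inc i τ)) (ℕ.+-suc b (weight τ))

inc-inc-≢ : ∀ {k} (i j : Fin k) {τ} → τ ≢ inc j (inc i τ)
inc-inc-≢ i j {τ} e = ℕ.m≢1+n+m (weight τ) {1} (trans (cong weight e)
  (trans (weight-inc j (inc i τ)) (cong suc (weight-inc i τ))))

-- The mixed cases are excluded by `weight`: a step up equal to a step down would make `τ` heavier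
-- than itself by two.
move-injective : ∀ {k} (δ ε : Direction k) {τ σ} → move δ τ ≡ just σ → move ε τ ≡ just σ → δ ≡ ε
move-injective (inj₁ i) (inj₁ j) refl e = cong inj₁ (sym (inc-axis-injective j i (Maybe.just-injective e)))
move-injective (inj₂ i) (inj₂ j) {τ} {σ} e e′ =
  cong inj₂ (inc-axis-injective i j (trans (sym (inc-dec? i τ e)) (inc-dec? j τ e′)))
move-injective (inj₁ i) (inj₂ j) {τ} refl e = contradiction (inc-dec? j τ e) (inc-inc-≢ i j)
move-injective (inj₂ i) (inj₁ j) {τ} e refl = contradiction (inc-dec? i τ e) (inc-inc-≢ j i)

Near : ∀ {k} → Vec ℕ k → Vec ℕ k → Set
Near τ σ = (∃ λ i → σ ≡ inc i τ) ⊎ (∃ λ i → τ ≡ inc i σ)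

near-sym : ∀ {k} {τ σ : Vec ℕ k} → Near τ σ → Near σ τ
near-sym (inj₁ x) = inj₂ x
near-sym (inj₂ x) = inj₁ x

near-irrefl : ∀ {k} {τ : Vec ℕ k} → ¬ Near τ τ
near-irrefl {τ = τ} (inj₁ (i , e)) = ℕ.1+n≢n (sym (trans (cong weight e) (weight-inc i τ)))
near-irrefl {τ = τ} (inj₂ (i , e)) = ℕ.1+n≢n (sym (trans (cong weight e) (weight-inc i τ)))

near? : ∀ {k} (τ σ : Vec ℕ k) → Dec (Near τ σ)
near? τ σ = Fin.any? (λ i → σ ≟ inc i τ) ⊎-dec Fin.any? (λ i → τ ≟ inc i σ)
  where _≟_ = Vec.≡-dec ℕ._≟_

near⇒move : ∀ {k} {τ σ : Vec ℕ k} → Near τ σ → ∃ λ δ → move δ τ ≡ just σ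
near⇒move         (inj₁ (i , refl)) = inj₁ i , refl
near⇒move {σ = σ} (inj₂ (i , refl)) = inj₂ i , dec?-inc i σ

move⇒near : ∀ {k} (δ : Direction k) {τ σ} → move δ τ ≡ just σ → Near τ σ
move⇒near (inj₁ i)     refl = inj₁ (i , refl)
move⇒near (inj₂ i) {τ} e    = inj₂ (i , inc-dec? i τ e)

near-lookup : ∀ {k} {τ σ : Vec ℕ k} → Near τ σ → ∀ j → lookup σ j ≤ suc (lookup τ j)
near-lookup {τ = τ} (inj₁ (i , refl)) j with i Fin.≟ j
... | yes refl = ℕ.≤-reflexive (inc-lookup i τ)
... | no  i≢j  = ℕ.≤-trans (ℕ.≤-reflexive (inc-lookup-≢ τ i≢j)) (ℕ.n≤1+n _)
near-lookup {σ = σ} (inj₂ (i , refl)) j with i Fin.≟ j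
... | yes refl = ℕ.≤-trans (ℕ.n≤1+n _) (ℕ.≤-trans (ℕ.≤-reflexive (sym (inc-lookup i σ))) (ℕ.n≤1+n _))
... | no  i≢j  = ℕ.≤-trans (ℕ.≤-reflexive (sym (inc-lookup-≢ σ i≢j))) (ℕ.n≤1+n _)

InBox : ∀ {k} → ℕ → Vec ℕ k → Set
InBox p = All (_≤ p)

inBox-inc : ∀ {k p} (i : Fin k) {τ} → InBox p τ → lookup τ i < p → InBox p (inc i τ)
inBox-inc zero    (_ ∷ bs)   b<p = b<p ∷ bs
inBox-inc (suc i) (b≤p ∷ bs) τᵢ<p = b≤p ∷ inBox-inc i bs τᵢ<p

inBox-inc⁻ : ∀ {k p} (i : Fin k) {τ} → InBox p (inc i τ) → InBox p τ
inBox-inc⁻ zero    {b ∷ τ} (b<p ∷ bs) = ℕ.<⇒≤ b<p ∷ bs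
inBox-inc⁻ (suc i) {b ∷ τ} (b≤p ∷ bs) = b≤p ∷ inBox-inc⁻ i bs

box-any? : ∀ {k} p {Q : Vec ℕ k → Set} → (∀ τ → Dec (Q τ)) → Dec (∃ λ τ → InBox p τ × Q τ)
box-any? {zero}  p Q? = map′ (λ q → [] , [] , q) (λ where ([] , [] , q) → q) (Q? [])
box-any? {suc k} p Q? = map′
  (λ (b , b<1+p , τ , bs , q) → b ∷ τ , s≤s⁻¹ b<1+p ∷ bs , q)
  (λ where (b ∷ τ , b≤p ∷ bs , q) → b , s≤s b≤p , τ , bs , q)
  (ℕ.anyUpTo? (λ b → box-any? p (λ τ → Q? (b ∷ τ))) (suc p))

-- Sequences of letters

-- Past the end of the sequence, its last letter.
at : ∀ {m p} → Vec (Fin m) (suc p) → ℕ → Fin m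
at             (x ∷ xs) zero    = x
at {p = zero}  (x ∷ xs) (suc b) = x
at {p = suc p} (x ∷ xs) (suc b) = at xs b

at-tail : ∀ {m p} (z : Vec (Fin m) (2+ p)) b → at (tail z) b ≡ at z (suc b)
at-tail (x ∷ z) b = refl

at-front : ∀ {m p} (z : Vec (Fin m) (2+ p)) b → b ≤ p → at (front z) b ≡ at z b
at-front {p = p}     (x ∷ z) zero    _         = refl
at-front {p = suc p} (x ∷ z) (suc b) (s≤s b≤p) = at-front z b b≤p

at-increasing : ∀ {m p} (x : Vec (Fin m) (suc p)) → Increasing x →
                ∀ {b c} → b < c → c ≤ p → at x b Fin.< at x c
at-increasing {p = suc p} (x ∷ y ∷ ys) (x<y , inc) {zero}  {suc zero}    _         _         = x<y
at-increasing {p = suc p} (x ∷ y ∷ ys) (x<y , inc) {zero}  {suc (suc c)} _         (s≤s c≤p) =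
  ℕ.<-trans x<y (at-increasing (y ∷ ys) inc (s≤s z≤n) c≤p)
at-increasing {p = suc p} (x ∷ y ∷ ys) (x<y , inc) {suc b} {suc c}       (s≤s b<c) (s≤s c≤p) =
  at-increasing (y ∷ ys) inc b<c c≤p

at-injective : ∀ {m p} (x : Vec (Fin m) (suc p)) → Increasing x →
               ∀ {b c} → b ≤ p → c ≤ p → at x b ≡ at x c → b ≡ c
at-injective x inc {b} {c} b≤p c≤p e with ℕ.<-cmp b c
... | tri< b<c _ _ = contradiction e (Fin.<⇒≢ (at-increasing x inc b<c c≤p))
... | tri≈ _ b≡c _ = b≡c
... | tri> _ _ c<b = contradiction (sym e) (Fin.<⇒≢ (at-increasing x inc c<b b≤p))

node : ∀ {m p k} → Vec (Vec (Fin m) (suc p)) k → Vec ℕ k → Fin (m ^ k)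
node []      []      = zero
node (x ∷ X) (b ∷ τ) = combine (at x b) (node X τ)

node-injective : ∀ {m p k} (X : Vec (Vec (Fin m) (suc p)) k) → All Increasing X →
                 ∀ {τ σ} → InBox p τ → InBox p σ → node X τ ≡ node X σ → τ ≡ σ
node-injective []      []          {[]}    {[]}    _          _          _ = refl
node-injective (x ∷ X) (inc ∷ incs) {b ∷ τ} {c ∷ σ} (b≤p ∷ bs) (c≤p ∷ cs) e = cong₂ _∷_
  (at-injective x inc b≤p c≤p (Fin.combine-injectiveˡ (at x b) (node X τ) (at x c) (node X σ) e))
  (node-injective X incs bs cs (Fin.combine-injectiveʳ (at x b) (node X τ) (at x c) (node X σ) e))

-- The two grids overlap in actual nodes, not merely up to isomorphism. Identifiers belong to nodes,
-- so they agree on the overlap.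
node-shiftAt : ∀ {m p k} (Z : Vec (Vec (Fin m) (2+ p)) k) (j : Fin k) {τ} → InBox p (inc j τ) →
                 node (shiftAt j Z) τ ≡ node (Vec.map front Z) (inc j τ)
node-shiftAt (z ∷ Z) zero    {b ∷ τ} (b<p ∷ bs) =
  cong (λ a → combine a (node (Vec.map front Z) τ)) (trans (at-tail z b) (sym (at-front z (suc b) b<p)))
node-shiftAt (z ∷ Z) (suc j) {b ∷ τ} (_ ∷ bs) = cong (combine (at (front z) b)) (node-shiftAt Z j bs)

-- Locality

subset-↔ : ∀ {n} (S : Subset n) → Fin ∣ S ∣ ↔ ∃ λ u → u ∈ S
subset-↔ S = mk↔ₛ′ (to S) (λ (u , u∈S) → from u∈S) (λ (u , u∈S) → to-from u∈S) (from-to S)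
  where
  to : ∀ {n} (S : Subset n) → Fin ∣ S ∣ → ∃ λ u → u ∈ S
  to (inside ∷ S)  zero    = zero , here
  to (inside ∷ S)  (suc i) = let u , u∈S = to S i in suc u , there u∈S
  to (outside ∷ S) i       = let u , u∈S = to S i in suc u , there u∈S
  from : ∀ {n} {S : Subset n} {u} → u ∈ S → Fin ∣ S ∣
  from {S = inside ∷ S}  here        = zero
  from {S = inside ∷ S}  (there u∈S) = suc (from u∈S)
  from {S = outside ∷ S} (there u∈S) = from u∈S
  to-from : ∀ {n} {S : Subset n} {u} (u∈S : u ∈ S) → to S (from u∈S) ≡ (u , u∈S)
  to-from {S = inside ∷ S}  here        = refl
  to-from {S = inside ∷ S}  (there u∈S) = cong (λ (u , p) → suc u , there p) (to-from u∈S)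
  to-from {S = outside ∷ S} (there u∈S) = cong (λ (u , p) → suc u , there p) (to-from u∈S)
  from-to : ∀ {n} (S : Subset n) i → from (proj₂ (to S i)) ≡ i
  from-to (inside ∷ S)  zero    = refl
  from-to (inside ∷ S)  (suc i) = cong suc (from-to S i)
  from-to (outside ∷ S) i       = from-to S i

element : ∀ {n} (S : Subset n) → Fin ∣ S ∣ → ∃ λ u → u ∈ S
element S = Inverse.to (subset-↔ S)

index : ∀ {n} (S : Subset n) {u} → u ∈ S → Fin ∣ S ∣
index S u∈S = Inverse.from (subset-↔ S) (_ , u∈S)

-- Ports follow the order of the nodes and so depend only on the neighbourhood: nodes with equal
-- neighbourhoods in two graphs have equal ports.
ordered-ports : ∀ {n} (G : Graph n) → PortNumbering G
ordered-ports G v = subset-↔ (Graph.N G v)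

module _ (A : Algorithm) {n c : ℕ} (ids : Identifiers c n) where
  open Algorithm A

  -- The neighbourhood determines the type of the state, so both are compared at once.
  Local : Set
  Local = Σ (Subset n) λ S → State ∣ S ∣

  local : Graph n → ℕ → Fin n → Local
  local G t v = Graph.N G v , Execution.stateAfter A G (ordered-ports G) ids t v

  private
    message : (x : Local) {v : Fin n} → v ∈ proj₁ x → Message
    message (S , s) v∈S = lookup (send s) (index S v∈S)

    message-cong : ∀ {x y : Local} {v} → x ≡ y → (p : v ∈ proj₁ x) (q : v ∈ proj₁ y) →
                   message x p ≡ message y q
    message-cong {x} refl p q = cong (message x) (Vec.[]=-irrelevant p q)

    receive-all : (x : Local) → (∀ {u} → u ∈ proj₁ x → Message) → Local
    receive-all (S , s) m = S , update s (tabulate λ i → m (proj₂ (element S i)))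

    receive-all-cong : ∀ {x y : Local} → x ≡ y →
      {m : ∀ {u} → u ∈ proj₁ x → Message} {m′ : ∀ {u} → u ∈ proj₁ y → Message} →
      (∀ {u} (p : u ∈ proj₁ x) (q : u ∈ proj₁ y) → m p ≡ m′ q) →
      receive-all x m ≡ receive-all y m′
    receive-all-cong {S , s} refl e =
      cong (λ ms → S , update s ms) (Vec.tabulate-cong λ i → e (proj₂ (element S i)) (proj₂ (element S i)))

  -- `Good t` describes nodes whose view of radius `t` is the same in both graphs. `spread` moves to
  -- a neighbour at the cost of one round, so induction on `t` shows that all messages received
  -- agree.
  locality : ∀ (G G′ : Graph n) (Good : ℕ → Fin n → Set) →
    (∀ {t v} → Good (suc t) v → Good t v) →
    (∀ {t v u} → Good (suc t) v → u ∈ Graph.N G v → Good t u) →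
    (∀ {t v} → Good t v → Graph.N G v ≡ Graph.N G′ v) →
    ∀ t {v} → Good t v → local G t v ≡ local G′ t v
  locality G G′ Good weaken spread same zero {v} good =
    cong (λ S → S , init ∣ S ∣ (Identifiers.ident ids v)) (same good)
  locality G G′ Good weaken spread same (suc t) {v} good =
    receive-all-cong (locality G G′ Good weaken spread same t (weaken good))
      {λ {u} u∈N → message (local G t u) (Graph.sym G u∈N)}
      {λ {u} u∈N → message (local G′ t u) (Graph.sym G′ u∈N)}
      λ p q → message-cong (locality G G′ Good weaken spread same t (spread good p)) (Graph.sym G p) (Graph.sym G′ q)

  private
    announced-cong : ∀ {x y : Local} → x ≡ y → {f g : Fin n → ℚ} →
      output (proj₂ x) ≡ just (tabulate λ i → f (proj₁ (element (proj₁ x) i))) →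
      output (proj₂ y) ≡ just (tabulate λ i → g (proj₁ (element (proj₁ y) i))) →
      ∀ {u} → u ∈ proj₁ x → f u ≡ g u
    announced-cong {S , s} refl {f} {g} ex ey {u} u∈S = begin
      f u                    ≡⟨ cong (f ∘ proj₁) here! ⟨
      f (proj₁ (element S i)) ≡⟨ Vec.lookup∘tabulate (λ i → f (proj₁ (element S i))) i ⟨
      lookup (tabulate λ i → f (proj₁ (element S i))) i ≡⟨ cong (λ v → lookup v i) (Maybe.just-injective (trans (sym ex) ey)) ⟩
      lookup (tabulate λ i → g (proj₁ (element S i))) i ≡⟨ Vec.lookup∘tabulate (λ i → g (proj₁ (element S i))) i ⟩
      g (proj₁ (element S i)) ≡⟨ cong (g ∘ proj₁) here! ⟩
      g u                    ∎
      where
      open ≡-Reasoning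
      i = index S u∈S
      here! : element S i ≡ (u , u∈S)
      here! = Inverse.strictlyInverseˡ (subset-↔ S) (u , u∈S)

  announced-agree : ∀ (G G′ : Graph n) t {x x′ v} → local G t v ≡ local G′ t v →
    Execution.Announces A G (ordered-ports G) ids t x →
    Execution.Announces A G′ (ordered-ports G′) ids t x′ →
    ∀ {u} → u ∈ Graph.N G v → EdgeFunction.value x v u ≡ EdgeFunction.value x′ v u
  announced-agree G G′ t {v = v} e a a′ = announced-cong e (a v) (a′ v)

own-index : ∀ c n → 1 ≤ c → Identifiers c n
own-index c n 1≤c = record
  { ident     = suc ∘ toℕ
  ; injective = Fin.toℕ-injective ∘ ℕ.suc-injective
  ; positive  = λ _ → s≤s z≤n
  ; bounded   = λ v → ℕ.≤-trans (Fin.toℕ<n v) (n≤n^c v)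
  }
  where
  n≤n^c : Fin n → n ≤ n ^ c
  n≤n^c v = ℕ.≤-trans (ℕ.≤-reflexive (sym (ℕ.^-identityʳ n)))
    (ℕ.^-monoʳ-≤ n {{ℕ.>-nonZero (ℕ.≤-trans (s≤s z≤n) (Fin.toℕ<n v))}} 1≤c)

-- The grid of a family of letter sequences

module Grid {m p k : ℕ} (X : Vec (Vec (Fin m) (suc p)) k) where

  Adjacent : Fin (m ^ k) → Fin (m ^ k) → Set
  Adjacent v u = ∃ λ τ → InBox p τ × v ≡ node X τ × (∃ λ σ → InBox p σ × Near τ σ × u ≡ node X σ)

  adjacent? : ∀ v u → Dec (Adjacent v u)
  adjacent? v u = box-any? p λ τ → (v Fin.≟ node X τ) ×-dec
                  box-any? p λ σ → near? τ σ ×-dec (u Fin.≟ node X σ)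

  opaque
    N : Fin (m ^ k) → Subset (m ^ k)
    N v = tabulate λ u → does (adjacent? v u)

    ∈N⇒ : ∀ {v u} → u ∈ N v → Adjacent v u
    ∈N⇒ {v} {u} u∈N = does-true (adjacent? v u)
      (trans (sym (Vec.lookup∘tabulate (λ u → does (adjacent? v u)) u)) (Vec.[]=⇒lookup u∈N))

    ⇒∈N : ∀ {v u} → Adjacent v u → u ∈ N v
    ⇒∈N {v} {u} adj = Vec.lookup⇒[]= u (N v)
      (trans (Vec.lookup∘tabulate (λ u → does (adjacent? v u)) u) (dec-true (adjacent? v u) adj))

  near⇒∈N : ∀ {τ σ} → InBox p τ → InBox p σ → Near τ σ → node X σ ∈ N (node X τ)
  near⇒∈N {τ} {σ} bτ bσ τ~σ = ⇒∈N (τ , bτ , refl , σ , bσ , τ~σ , refl)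

  module Increasing (incs : All Increasing X) where

    ∈N-node : ∀ {τ u} → InBox p τ → u ∈ N (node X τ) → ∃ λ σ → InBox p σ × Near τ σ × u ≡ node X σ
    ∈N-node bτ u∈N with ∈N⇒ u∈N
    ... | τ′ , bτ′ , e , rest with node-injective X incs bτ bτ′ e
    ... | refl = rest

    graph : Graph (m ^ k)
    graph = record
      { N      = N
      ; sym    = λ u∈N → let τ , bτ , v≡ , σ , bσ , τ~σ , u≡ = ∈N⇒ u∈N
                         in ⇒∈N (σ , bσ , u≡ , τ , bτ , near-sym τ~σ , v≡)
      ; irrefl = λ v v∈N → let τ , bτ , v≡ , σ , bσ , τ~σ , v≡′ = ∈N⇒ v∈N
                           in near-irrefl (subst (Near τ) (node-injective X incs bσ bτ (trans (sym v≡′) v≡)) τ~σ)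
      }

    neighbourTo : Vec ℕ k → Direction k → Maybe (Fin (m ^ k))
    neighbourTo τ δ = Maybe.map (node X) (move δ τ)

    near⇒neighbourTo : ∀ {τ σ} → Near τ σ → ∃ λ δ → neighbourTo τ δ ≡ just (node X σ)
    near⇒neighbourTo τ~σ = let δ , e = near⇒move τ~σ in δ , cong (Maybe.map (node X)) e

    degree≤ : MaxDegree≤ (k + k) graph
    degree≤ v with nonempty? (N v)
    ... | no  empty = ℕ.≤-trans (ℕ.≤-reflexive (trans (cong ∣_∣ (Empty-unique empty)) (∣⊥∣≡0 (m ^ k)))) z≤n
    ... | yes (u , u∈N) with ∈N⇒ u∈N
    ...   | τ , bτ , refl , _ = ℕ.≤-trans
      (covered-card (neighbourTo τ) (directions k) (N (node X τ)) λ u∈N →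
         let σ , _ , τ~σ , u≡ = ∈N-node bτ u∈N
             δ , e = near⇒neighbourTo τ~σ
         in δ , ∈-directions δ , trans e (cong just (sym u≡)))
      (ℕ.≤-reflexive (length-directions k))

    module _ (x : EdgeFunction graph) where
      open EdgeFunction x

      val : Fin k → Vec ℕ k → ℚ
      val i τ = value (node X τ) (node X (inc i τ))

      -- A backward step never leaves the box, and the hypotheses keep the forward steps inside it.
      -- The possible moves from `τ` therefore enumerate its neighbours, without repetition by
      -- `move-injective` and `node-injective`.
      value-load : ∀ {τ} → InBox p τ → (∀ i → InBox p (inc i τ)) → _[_] (node X τ) ≡ load val τ
      value-load {τ} bτ b⁺ = trans
        (sum-over-image (neighbourTo τ) (value (node X τ)) injective (N (node X τ)) (directions k)
          (directions-unique k)
          (λ u∈N → let σ , _ , τ~σ , u≡ = ∈N-node bτ u∈N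
                       δ , e = near⇒neighbourTo τ~σ
                   in δ , ∈-directions δ , trans e (cong just (sym u≡)))
          (λ {_} {δ} _ e → let σ , e′ , u≡ = image δ e
                       in subst (_∈ N (node X τ)) u≡ (near⇒∈N bτ (inBox δ e′) (move⇒near δ e′))))
        (begin
          Σℚ (directions k) w
            ≡⟨ Σℚ-++ (List.map inj₁ (allFin k)) (List.map inj₂ (allFin k)) ⟩
          Σℚ (List.map inj₁ (allFin k)) w ⊕ Σℚ (List.map inj₂ (allFin k)) w
            ≡⟨ cong₂ _⊕_ (Σℚ-map inj₁ (allFin k)) (Σℚ-map inj₂ (allFin k)) ⟩
          Σℚ (allFin k) (λ i → val i τ) ⊕ Σℚ (allFin k) (λ i → w (inj₂ i))
            ≡⟨ Σℚ-⊕ (allFin k) ⟨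
          Σℚ (allFin k) (λ i → val i τ ⊕ w (inj₂ i))
            ≡⟨ Σℚ-cong (allFin k) (λ i → cong (val i τ ⊕_) (backwards i)) ⟩
          load val τ ∎)
        where
        open ≡-Reasoning
        w : Direction k → ℚ
        w δ = maybe′ (value (node X τ)) 0ℚ (neighbourTo τ δ)
        inBox : ∀ δ {σ} → move δ τ ≡ just σ → InBox p σ
        inBox (inj₁ i) refl = b⁺ i
        inBox (inj₂ i) e    = inBox-inc⁻ i (subst (InBox p) (inc-dec? i τ e) bτ)
        image : ∀ δ {u} → neighbourTo τ δ ≡ just u → ∃ λ σ → move δ τ ≡ just σ × node X σ ≡ u
        image δ e with move δ τ
        image δ refl | just σ = σ , refl , refl
        injective : ∀ {δ ε u} → neighbourTo τ δ ≡ just u → neighbourTo τ ε ≡ just u → δ ≡ ε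
        injective {δ} {ε} e e′ =
          let σ , f , u≡ = image δ e ; σ′ , f′ , u≡′ = image ε e′
          in move-injective δ ε f (subst (λ ρ → move ε τ ≡ just ρ)
               (node-injective X incs (inBox ε f′) (inBox δ f) (trans u≡′ (sym u≡))) f′)
        backwards : ∀ i → w (inj₂ i) ≡ back i (val i) τ
        backwards i with dec? i τ in e
        ... | nothing = refl
        ... | just σ  = trans (value-sym (near⇒∈N (inBox (inj₂ i) e) bτ (near-sym (move⇒near (inj₂ i) e))))
                              (cong (λ ρ → value (node X σ) (node X ρ)) (inc-dec? i τ e))

-- Shifting the letters of one axis

module _ {m p k : ℕ} (Z : Vec (Vec (Fin m) (2+ p)) k) (j : Fin k) where

  private
    X  = Vec.map front Z
    X′ = shiftAt j Z

  -- A margin of more than `t` along axis `j`, the only axis on which the two grids differ. Position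
  -- `τ` of `X′` is position `inc j τ` of `X`, whence the extra unit in the upper bound.
  Interior : ℕ → Fin (m ^ k) → Set
  Interior t v = ∃ λ τ → InBox p τ × t < lookup τ j × 2 + (t + lookup τ j) ≤ p × v ≡ node X′ τ

  module _ (incs : All Increasing X) (incs′ : All Increasing X′) where

    private
      module G  = Grid X
      module G′ = Grid X′
      module I  = G.Increasing incs
      module I′ = G′.Increasing incs′

      shifted : ∀ {σ} → InBox p σ → lookup σ j < p → InBox p (inc j σ)
      shifted bσ σⱼ<p = inBox-inc j bσ σⱼ<p

    interior-weaken : ∀ {t v} → Interior (suc t) v → Interior t v
    interior-weaken (τ , bτ , lo , hi , e) = τ , bτ , ℕ.<⇒≤ lo , ℕ.<⇒≤ hi , e

    interior-spread : ∀ {t v u} → Interior (suc t) v → u ∈ G′.N v → Interior t u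
    interior-spread {t} (τ , bτ , lo , hi , refl) u∈N =
      let σ , bσ , τ~σ , u≡ = I′.∈N-node bτ u∈N
      in σ , bσ , s≤s⁻¹ (ℕ.≤-trans lo (near-lookup (near-sym τ~σ) j)) ,
         ℕ.≤-trans (ℕ.+-monoʳ-≤ (2 + t) (near-lookup τ~σ j))
                   (ℕ.≤-trans (ℕ.≤-reflexive (ℕ.+-suc (2 + t) (lookup τ j))) hi) , u≡

    -- Translation along axis `j` matches the neighbours. The upper margin keeps translated
    -- neighbours inside `X`; the lower one is what allows a downward step on axis `j` to be undone
    -- in `X′`.
    interior-same : ∀ {t v} → Interior t v → G′.N v ≡ G.N v
    interior-same {t} (τ , bτ , lo , hi , refl) = ⊆-antisym to from
      where
      2+τⱼ≤p : 2 + lookup τ j ≤ p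
      2+τⱼ≤p = ℕ.≤-trans (ℕ.+-monoʳ-≤ 2 (ℕ.m≤n+m (lookup τ j) t)) hi
      bτ⁺ : InBox p (inc j τ)
      bτ⁺ = shifted bτ (ℕ.≤-trans (ℕ.n≤1+n _) 2+τⱼ≤p)
      v≡ : node X′ τ ≡ node X (inc j τ)
      v≡ = node-shiftAt Z j bτ⁺
      near-inc : ∀ {σ} → Near τ σ → Near (inc j τ) (inc j σ)
      near-inc (inj₁ (i , refl)) = inj₁ (i , inc-comm j i _)
      near-inc (inj₂ (i , refl)) = inj₂ (i , inc-comm j i _)
      to : ∀ {u} → u ∈ G′.N (node X′ τ) → u ∈ G.N (node X′ τ)
      to u∈N =
        let σ , bσ , τ~σ , u≡ = I′.∈N-node bτ u∈N
            bσ⁺ = shifted bσ (ℕ.≤-trans (s≤s (near-lookup τ~σ j)) 2+τⱼ≤p)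
        in G.⇒∈N (inc j τ , bτ⁺ , v≡ , inc j σ , bσ⁺ , near-inc τ~σ , trans u≡ (node-shiftAt Z j bσ⁺))
      unshift : ∀ {σ} → InBox p σ → Near (inc j τ) σ → ∃ λ ρ → InBox p ρ × Near τ ρ × σ ≡ inc j ρ
      unshift bσ (inj₁ (i , refl)) =
        inc i τ , inBox-inc⁻ j (subst (InBox p) (inc-comm i j τ) bσ) , inj₁ (i , refl) , inc-comm i j τ
      unshift {σ} bσ (inj₂ (i , e)) with i Fin.≟ j
      ... | no i≢j = let ρ , τ≡ , σ≡ = inc-diamond i j i≢j e
                     in ρ , inBox-inc⁻ i (subst (InBox p) τ≡ bτ) , inj₂ (i , τ≡) , σ≡
      ... | yes refl =
        let ρ , e′ = dec?-pos j τ (ℕ.≤-trans (s≤s z≤n) lo)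
            τ≡ = inc-dec? j τ e′
        in ρ , inBox-inc⁻ j (subst (InBox p) τ≡ bτ) , inj₂ (j , τ≡) ,
           trans (sym (inc-injective j e)) τ≡
      from : ∀ {u} → u ∈ G.N (node X′ τ) → u ∈ G′.N (node X′ τ)
      from {u} u∈N =
        let σ , bσ , τ~σ , u≡ = I.∈N-node bτ⁺ (subst (λ v → u ∈ G.N v) v≡ u∈N)
            ρ , bρ , τ~ρ , σ≡ = unshift bσ τ~σ
        in G′.⇒∈N (τ , bτ , refl , ρ , bρ , τ~ρ ,
             trans u≡ (trans (cong (node X) σ≡) (sym (node-shiftAt Z j (subst (InBox p) σ≡ bσ)))))

    val-shift : ∀ (A : Algorithm) {c} (ids : Identifiers c (m ^ k)) t {x x′} →
      Execution.Announces A I.graph (ordered-ports I.graph) ids t x →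
      Execution.Announces A I′.graph (ordered-ports I′.graph) ids t x′ →
      ∀ {τ} i → InBox p τ → InBox p (inc i τ) → InBox p (inc j (inc i τ)) →
      t < lookup τ j → 2 + (t + lookup τ j) ≤ p →
      I′.val x′ i τ ≡ I.val x i (inc j τ)
    val-shift A ids t {x} {x′} a a′ {τ} i bτ bi bji lo hi = trans
      (announced-agree A ids I′.graph I.graph t {x′} {x}
        (locality A ids I′.graph I.graph Interior interior-weaken interior-spread interior-same t
          (τ , bτ , lo , hi , refl))
        a′ a (G′.near⇒∈N bτ bi (inj₁ (i , refl))))
      (cong₂ (EdgeFunction.value x) (node-shiftAt Z j (inBox-inc⁻ i (subst (InBox p) (inc-comm j i τ) bji)))
        (trans (node-shiftAt Z j bji) (cong (node X) (inc-comm j i τ))))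

-- Truncated sequences and enumeration of boxes

front-increasing : ∀ {m p} (z : Vec (Fin m) (suc p)) → Increasing z → Increasing (front z)
front-increasing (x ∷ [])         _               = _
front-increasing (x ∷ y ∷ [])     _               = _
front-increasing (x ∷ y ∷ w ∷ ys) (x<y , inc)     = x<y , front-increasing (y ∷ w ∷ ys) inc

tail-increasing : ∀ {m p} (z : Vec (Fin m) (suc p)) → Increasing z → Increasing (tail z)
tail-increasing (x ∷ [])     _         = _
tail-increasing (x ∷ y ∷ ys) (_ , inc) = inc

fronts-increasing : ∀ {m p k} (Z : Vec (Vec (Fin m) (suc p)) k) → All Increasing Z → All Increasing (Vec.map front Z)
fronts-increasing []      []           = []
fronts-increasing (z ∷ Z) (inc ∷ incs) = front-increasing z inc ∷ fronts-increasing Z incs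

shiftAt-increasing : ∀ {m p k} (j : Fin k) (Z : Vec (Vec (Fin m) (suc p)) k) → All Increasing Z → All Increasing (shiftAt j Z)
shiftAt-increasing zero    (z ∷ Z) (inc ∷ incs) = tail-increasing z inc ∷ fronts-increasing Z incs
shiftAt-increasing (suc j) (z ∷ Z) (inc ∷ incs) = front-increasing z inc ∷ shiftAt-increasing j Z incs

inBox-lookup : ∀ {k p} {τ : Vec ℕ k} → InBox p τ → ∀ i → lookup τ i ≤ p
inBox-lookup (b≤p ∷ _)  zero    = b≤p
inBox-lookup (_ ∷ bs) (suc i) = inBox-lookup bs i

inBox-mono : ∀ {k p q} {τ : Vec ℕ k} → p ≤ q → InBox p τ → InBox q τ
inBox-mono p≤q = All.map (λ b≤p → ℕ.≤-trans b≤p p≤q)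

inBox-suc : ∀ {k p} (i : Fin k) {τ} → InBox p τ → InBox (suc p) (inc i τ)
inBox-suc {p = p} i bτ = inBox-inc i (inBox-mono (ℕ.n≤1+n p) bτ) (s≤s (inBox-lookup bτ i))

box : ∀ {k} p → Fin (suc p ^ k) → Vec ℕ k
box p e = tabulate (λ i → toℕ (finToFun e i))

box-surjective : ∀ {k p} {τ : Vec ℕ k} → InBox p τ → ∃ λ e → box p e ≡ τ
box-surjective {p = p} {τ} bτ = funToFin f ,
  trans (Vec.tabulate-cong λ i → trans (cong toℕ (Fin.finToFun-funToFin f i)) (Fin.toℕ-fromℕ< _))
        (Vec.tabulate∘lookup τ)
  where
  f : Fin _ → Fin (suc p)
  f i = fromℕ< (s≤s (inBox-lookup bτ i))

-- Colours

palette : ℕ → ℕ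
palette M = suc M * M

code : ∀ {M x} → FractionUpTo M x → Fin (palette M)
code (a , b , a≤M , b<M , _) = combine (fromℕ< (s≤s a≤M)) (fromℕ< b<M)

-- The code records the representation `a / b` supplied with the value, and a representation
-- determines the value.
code-injective : ∀ {M x y} (f : FractionUpTo M x) (g : FractionUpTo M y) → code f ≡ code g → x ≡ y
code-injective {M} {x} {y} (a , b , a≤M , b<M , x≡) (a′ , b′ , a′≤M , b′<M , y≡) e =
  trans x≡ (trans (cong₂ (λ a b → + a ℚ./ suc b) a≡ b≡) (sym y≡))
  where
  a≡ : a ≡ a′
  a≡ = Fin.fromℕ<-injective _ _ (s≤s a≤M) (s≤s a′≤M) (Fin.combine-injectiveˡ _ (fromℕ< b<M) _ (fromℕ< b′<M) e)
  b≡ : b ≡ b′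
  b≡ = Fin.fromℕ<-injective _ _ b<M b′<M (Fin.combine-injectiveʳ (fromℕ< (s≤s a≤M)) _ (fromℕ< (s≤s a′≤M)) _ e)

module _ {m p k M : ℕ} (blank : Fin (palette M)) where

  module _ (X : Vec (Vec (Fin m) (suc p)) k) (incs : All Increasing X) where
    open Grid X
    open Increasing incs

    hue : (x : EdgeFunction graph) → AllValues x (FractionUpTo M) → Fin k → Vec ℕ k → Fin (palette M)
    hue x fr i τ with All.all? (ℕ._≤? p) τ ×-dec All.all? (ℕ._≤? p) (inc i τ)
    ... | yes (bτ , bi) = code (fr (near⇒∈N bi bτ (inj₂ (i , refl))))
    ... | no  _         = blank

    -- The complete table of edge values by axis and position. Equal colours thus mean equal
    -- solutions position by position, although the nodes at these positions differ.
    colour : (x : EdgeFunction graph) → AllValues x (FractionUpTo M) → Fin (patterns (palette M) k (suc p))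
    colour x fr = funToFin λ i → funToFin λ e → hue x fr i (box p e)

  module _ {X X′ : Vec (Vec (Fin m) (suc p)) k} {incs : All Increasing X} {incs′ : All Increasing X′} where
    private
      module I  = Grid.Increasing X incs
      module I′ = Grid.Increasing X′ incs′

    colour-val : ∀ {x x′} (fr : AllValues x (FractionUpTo M)) (fr′ : AllValues x′ (FractionUpTo M)) →
                 colour X incs x fr ≡ colour X′ incs′ x′ fr′ →
                 ∀ i {τ} → InBox p τ → InBox p (inc i τ) → I.val x i τ ≡ I′.val x′ i τ
    colour-val {x} {x′} fr fr′ e i {τ} bτ bi =
      let ε , box≡τ = box-surjective bτ
      in same-hue (subst (λ τ → hue X incs x fr i τ ≡ hue X′ incs′ x′ fr′ i τ) box≡τ
                         (funToFin-injective (funToFin-injective e i) ε))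
      where
      same-hue : hue X incs x fr i τ ≡ hue X′ incs′ x′ fr′ i τ → I.val x i τ ≡ I′.val x′ i τ
      same-hue e with All.all? (ℕ._≤? p) τ ×-dec All.all? (ℕ._≤? p) (inc i τ)
      ... | yes _ = code-injective (fr _) (fr′ _) e
      ... | no ¬b = contradiction (bτ , bi) ¬b

-- Shift invariance

module _ (t : ℕ) where

  private
    -- `q = 2 * t + 2` is even, as the weights require, and `q - 1` exceeds `t`. The choice of `p`
    -- makes `2 + (t + q)` equal to `p`, so positions up to `q` keep the margin needed for `t`
    -- rounds.
    p = 4 + 3 * t
    q = suc t * 2

    2+q≤p : 2 + q ≤ p
    2+q≤p = ℕ.≤-trans (ℕ.≤-reflexive (cong (λ b → 4 + b) (ℕ.*-comm t 2)))
      (ℕ.+-monoʳ-≤ 4 (ℕ.m≤n+m (2 * t) t))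

  inner : ∀ {k} {τ : Vec ℕ k} → InBox q τ → InBox p τ
  inner = inBox-mono (ℕ.≤-trans (ℕ.m≤n+m q 2) 2+q≤p)

  inner-inc : ∀ {k} (i : Fin k) {τ} → InBox q τ → InBox p (inc i τ)
  inner-inc i bτ = inBox-mono (ℕ.≤-trans (ℕ.n≤1+n (suc q)) 2+q≤p) (inBox-suc i bτ)

  inner-inc² : ∀ {k} (i j : Fin k) {τ} → InBox q τ → InBox p (inc i (inc j τ))
  inner-inc² i j bτ = inBox-mono 2+q≤p (inBox-suc i (inBox-suc j bτ))

  shift-lo : ∀ {b} → q ≤ suc b → t < b
  shift-lo (s≤s q≤b) = ℕ.≤-trans (s≤s (ℕ.m≤m*n t 2)) q≤b

  shift-hi : ∀ {b} → b ≤ q → 2 + (t + b) ≤ p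
  shift-hi b≤q = ℕ.≤-trans (ℕ.+-monoʳ-≤ 2 (ℕ.+-monoʳ-≤ t b≤q)) (ℕ.≤-reflexive
    (solve 1 (λ t → con 2 :+ (t :+ (con 1 :+ t) :* con 2) := con 4 :+ con 3 :* t) refl t))
    where open ℕ.+-*-Solver

module _ {m k : ℕ} (t : ℕ) {X : Vec (Vec (Fin m) (5 + 3 * t)) k} (incs : All Increasing X) where
  open Grid X
  open Increasing incs

  private
    q = suc t * 2

  -- Within the box the bound allows coordinate `j` to be `q - 1` or `q`. The former gives
  -- periodicity of the edges along axis `j`; the latter compares the loads on the face with those
  -- one step beyond.
  ShiftInvariant : EdgeFunction graph → Set
  ShiftInvariant x = ∀ j i {τ} → InBox q τ → q ≤ suc (lookup τ j) → val x i τ ≡ val x i (inc j τ)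

  module _ {x : EdgeFunction graph} (inv : ShiftInvariant x) where
    open EdgeFunction x

    val-periodic : ∀ i τ → InBox q τ → lookup τ i ≡ q → val x i τ ≡ back i (val x i) τ
    val-periodic i τ bτ τᵢ≡q with dec? i τ in e
    ... | nothing = contradiction (trans (sym e) (proj₂ (dec?-pos i τ (subst (0 <_) (sym τᵢ≡q) (s≤s z≤n))))) λ ()
    ... | just σ with inc-dec? i τ e
    ...   | refl = sym (inv i i (inBox-inc⁻ i bτ)
                     (ℕ.≤-reflexive (trans (sym τᵢ≡q) (inc-lookup i σ))))

    -- For `l = i` this is periodicity again, since the edge entering `inc i τ` is the one leaving
    -- `τ`. For `l ≠ i` the steps commute, so both entering edges exist or neither does, and
    -- invariance applies one step back.
    back-invariant : ∀ i l τ → InBox q τ → lookup τ i ≡ q →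
                     back l (val x l) τ ≡ back l (val x l) (inc i τ)
    back-invariant i l τ bτ τᵢ≡q with l Fin.≟ i
    ... | yes refl = trans (sym (val-periodic i τ bτ τᵢ≡q))
                           (cong (maybe′ (val x i) 0ℚ) (sym (dec?-inc i τ)))
    ... | no l≢i with dec? l τ in e | dec? l (inc i τ) in e′
    ...   | nothing | nothing = refl
    ...   | nothing | just ρ  =
      let ρ′ , τ≡ , _ = inc-diamond l i l≢i (inc-dec? l (inc i τ) e′)
      in contradiction (trans (sym e) (trans (cong (dec? l) τ≡) (dec?-inc l ρ′))) λ ()
    ...   | just σ  | w with inc-dec? l τ e
    ...     | refl with trans (sym e′) (trans (cong (dec? l) (inc-comm i l σ)) (dec?-inc l (inc i σ)))
    ...       | refl = inv i l (inBox-inc⁻ l bτ)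
                         (ℕ.≤-trans (ℕ.≤-reflexive (trans (sym τᵢ≡q) (inc-lookup-≢ σ l≢i))) (ℕ.n≤1+n _))

    load-invariant : ∀ i τ → InBox q τ → lookup τ i ≡ q → load (val x) τ ≡ load (val x) (inc i τ)
    load-invariant i τ bτ τᵢ≡q = Σℚ-cong (allFin k) λ l →
      cong₂ _⊕_ (inv i l bτ (ℕ.≤-trans (ℕ.≤-reflexive (sym τᵢ≡q)) (ℕ.n≤1+n _)))
                (back-invariant i l τ bτ τᵢ≡q)

    -- Maximality saturates one end of the edge from `τ` to `inc i τ`, and both ends have the same
    -- load.
    load-saturated : IsMaximalFractionalMatching x →
                     ∀ i τ → InBox q τ → lookup τ i ≡ q → load (val x) τ ≡ 1ℚ
    load-saturated max i τ bτ τᵢ≡q = Sum.[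
        (λ sat⁺ → trans (load-invariant i τ bτ τᵢ≡q)
          (trans (sym (value-load x (inner-inc t i bτ) λ l → inner-inc² t l i bτ)) sat⁺)) ,
        (λ sat → trans (sym (value-load x (inner t bτ) λ l → inner-inc t l bτ)) sat) ]′
      (IsMaximalFractionalMatching.saturated max (near⇒∈N (inner t bτ) (inner-inc t i bτ) (inj₁ (i , refl))))

  shift-invariance-impossible : ∀ {d} {x : EdgeFunction graph} → k ≡ suc d → ShiftInvariant x →
    IsMaximalFractionalMatching x → ¬ AllValues x (FractionUpTo (2 ^ d))
  shift-invariance-impossible {d} {x} refl inv max fr = no-deficit-pattern d (suc t) (val x)
    (λ i τ bτ → fr (near⇒∈N (inner-inc t i bτ) (inner t bτ) (inj₂ (i , refl))))
    (val-periodic {x} inv)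
    (load-saturated {x} inv max)

-- Shift-invariant solutions from an algorithm

record Solution (A : Algorithm) {m p k c : ℕ} (ids : Identifiers c (m ^ k)) (t M : ℕ)
                (X : Vec (Vec (Fin m) (suc p)) k) (incs : All Increasing X) : Set where
  open Grid.Increasing X incs
  field
    x         : EdgeFunction graph
    announced : Execution.Announces A graph (ordered-ports graph) ids t x
    maximal   : IsMaximalFractionalMatching x
    fractions : AllValues x (FractionUpTo M)

module _ (A : Algorithm) {m k c : ℕ} (ids : Identifiers c (m ^ k)) (t M : ℕ) (blank : Fin (palette M)) where

  private
    p = 4 + 3 * t

    Solved : (X : Vec (Vec (Fin m) (suc p)) k) → All Increasing X → Set
    Solved = Solution A ids t M

  colour-solution : ∀ X incs → Solved X incs → Fin (patterns (palette M) k (suc p))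
  colour-solution X incs s = colour blank X incs (Solution.x s) (Solution.fractions s)

  -- Two comparisons are chained. Equal colours equate the values at position `τ` of the two grids;
  -- locality equates position `τ` of the shifted grid with position `inc j τ` of the original one,
  -- the same node.
  shift-invariant-along : ∀ (Z : Vec (Vec (Fin m) (2+ p)) k) j incs incs′
    (s : Solved (Vec.map front Z) incs) (s′ : Solved (shiftAt j Z) incs′) →
    colour-solution (Vec.map front Z) incs s ≡ colour-solution (shiftAt j Z) incs′ s′ →
    ∀ i {τ} → InBox (suc t * 2) τ → suc t * 2 ≤ suc (lookup τ j) →
    Grid.Increasing.val (Vec.map front Z) incs (Solution.x s) i τ ≡
    Grid.Increasing.val (Vec.map front Z) incs (Solution.x s) i (inc j τ)
  shift-invariant-along Z j incs incs′ s s′ e i bτ q≤ = trans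
    (colour-val blank {incs = incs} {incs′ = incs′} (Solution.fractions s) (Solution.fractions s′) e i
      (inner t bτ) (inner-inc t i bτ))
    (val-shift Z j incs incs′ A ids t {Solution.x s} {Solution.x s′} (Solution.announced s) (Solution.announced s′)
      i (inner t bτ) (inner-inc t i bτ) (inner-inc² t j i bτ)
      (shift-lo t q≤) (shift-hi t (inBox-lookup bτ j)))

  module _ (solve : ∀ X incs → Solved X incs) where

    -- The shift argument colours all tuples of sequences, while the grids require increasing ones;
    -- the remaining tuples share one constant colour.
    colour-sequences : ∀ X → Dec (All Increasing X) → Fin (patterns (palette M) k (suc p))
    colour-sequences X (yes incs) = colour-solution X incs (solve X incs)
    colour-sequences X (no  _)    =
      funToFin {k} {palette M ^ (suc p ^ k)} λ _ → funToFin {suc p ^ k} {palette M} λ _ → blank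

    shift-invariant-solution : threshold p k (patterns (palette M) k (suc p)) ≤ m →
      ∃₂ λ X incs → ∃ λ (s : Solved X incs) → ShiftInvariant t incs (Solution.x s)
    shift-invariant-solution thr≤m =
      let Z , incs , inv = shift-invariant p k (patterns (palette M) k (suc p)) m thr≤m
                             (λ X → colour-sequences X (All.all? increasing? X))
      in go Z incs (All.all? increasing? (Vec.map front Z)) inv
      where
      go : ∀ Z → All Increasing Z → (X? : Dec (All Increasing (Vec.map front Z))) →
        (∀ j → colour-sequences (Vec.map front Z) X? ≡
               colour-sequences (shiftAt j Z) (All.all? increasing? (shiftAt j Z))) →
        ∃₂ λ X incs → ∃ λ (s : Solved X incs) → ShiftInvariant t incs (Solution.x s)
      go Z incs (no ¬incs)  _   = contradiction (fronts-increasing Z incs) ¬incs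
      go Z incs (yes incsX) inv = Vec.map front Z , incsX , solve (Vec.map front Z) incsX ,
        λ j i bτ q≤ → along j i bτ q≤ (All.all? increasing? (shiftAt j Z)) (inv j)
        where
        along : ∀ j i {τ} → InBox (suc t * 2) τ → suc t * 2 ≤ suc (lookup τ j) →
          (X′? : Dec (All Increasing (shiftAt j Z))) →
          colour-sequences (Vec.map front Z) (yes incsX) ≡ colour-sequences (shiftAt j Z) X′? →
          Grid.Increasing.val (Vec.map front Z) incsX (Solution.x (solve (Vec.map front Z) incsX)) i τ ≡
          Grid.Increasing.val (Vec.map front Z) incsX (Solution.x (solve (Vec.map front Z) incsX)) i (inc j τ)
        along j i bτ q≤ (no ¬incs)  _ = contradiction (shiftAt-increasing j Z incs) ¬incs
        along j i bτ q≤ (yes incs′) e = shift-invariant-along Z j incsX incs′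
          (solve (Vec.map front Z) incsX) (solve (shiftAt j Z) incs′) e i bτ q≤

solve-grid : ∀ {A c M T m p k} → FindsMFM c (k + k) (FractionUpTo M) A T →
  (ids : Identifiers c (m ^ k)) (X : Vec (Vec (Fin m) (suc p)) k) (incs : All Increasing X) →
  Solution A ids (T (m ^ k)) M X incs
solve-grid finds ids X incs =
  let x , announced , maximal , fractions =
        finds graph degree≤ (ordered-ports graph) ids
  in record { x = x ; announced = announced ; maximal = maximal ; fractions = fractions }
  where open Grid.Increasing X incs

FindsMFM-impossible : ∀ {c d k} A T → k ≡ suc d → 1 ≤ c → T ∈o log* →
  ¬ FindsMFM c (k + k) (FractionUpTo (2 ^ d)) A T
FindsMFM-impossible {c} {d} {k} A T k≡ 1≤c T∈o finds =
  let m , thr≤m = room (palette (2 ^ d)) k T (subst (1 ≤_) (sym k≡) (s≤s z≤n)) T∈o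
      ids = own-index c (m ^ k) 1≤c
      -- The blank colour may be any element of the palette; the code of 1 shows that there is one.
      X , incs , s , inv = shift-invariant-solution A ids (T (m ^ k)) (2 ^ d) (code {x = 1ℚ} 1∈)
                             (solve-grid {T = T} finds ids) thr≤m
  in shift-invariance-impossible (T (m ^ k)) incs {x = Solution.x s} k≡ inv (Solution.maximal s) (Solution.fractions s)
  where
  1∈ : FractionUpTo (2 ^ d) 1ℚ
  1∈ = 1 , 0 , ℕ.m^n>0 2 d , ℕ.m^n>0 2 d , refl

theorem1p2 : (d c : ℕ) → 1 ≤ c →
    ¬ (Σ[ A ∈ Algorithm ] Σ[ T ∈ (ℕ → ℕ) ]
    (T ∈o log*) × FindsMFM c (2 * d + 2) (FractionUpTo (2 ^ d)) A T)
theorem1p2 d c 1≤c (A , T , T∈o , finds) = FindsMFM-impossible A T refl 1≤c T∈o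
  (subst (λ Δ → FindsMFM c Δ (FractionUpTo (2 ^ d)) A T)
    (solve 1 (λ d → con 2 :* d :+ con 2 := (con 1 :+ d) :+ (con 1 :+ d)) refl d) finds)
  where open ℕ.+-*-Solver
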